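{- There is no computably enumerable binary relation $\mathrel{\epsilon}$ on $\mathbb N$ together with a co-c.e. equivalence relation $E$ on $\mathbb N$ that is a congruence with respect to $\mathrel{\epsilon}$, such that $\langle\mathbb N,\mathrel{\epsilon}\rangle/E$ is a model of set theory (e.g., of ZFC or of KP).
   Context: $E$ is a congruence with respect to $\mathrel{\epsilon}$ if $x\,E\,x'$ and $y\,E\,y'$ imply ($x\mathrel{\epsilon} y\iff x'\mathrel{\epsilon} y'$). Co-c.e. means the complement is computably enumerable. "Set theory" means a set theory such as ZFC or Kripke–Platek set theory KP (proving the existence of the set of natural numbers and of sets defined from it such as the set of Kuratowski pairs $\langle n,n+1\rangle$, the set of singletons $\{n\}$ and of doubletons $\{n,m\}$ of natural numbers). -}

module Defs where

open import Data.Nat using (ℕ; zero; suc; _<_)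
open import Data.Fin using (Fin)
open import Data.Vec using (Vec; []; _∷_; lookup)
open import Data.Product using (Σ; _×_; _,_)
open import Data.Empty using (⊥)
open import Relation.Nullary using (¬_)
open import Relation.Binary.Structures using (IsEquivalence)

data PR : ℕ → Set where
  zer  : ∀ {n} → PR n
  succ : PR 1
  proj : ∀ {n} → Fin n → PR n
  comp : ∀ {m n} → PR m → Vec (PR n) m → PR n
  prec : ∀ {n} → PR n → PR (suc (suc n)) → PR (suc n)
  mu   : ∀ {n} → PR (suc n) → PR n

mutual
  data _[_]⇓_ : ∀ {n} → PR n → Vec ℕ n → ℕ → Set where
    ev-zer  : ∀ {n} {xs : Vec ℕ n} → zer [ xs ]⇓ 0
    ev-succ : ∀ {x} → succ [ x ∷ [] ]⇓ suc x
    ev-proj : ∀ {n} {i : Fin n} {xs} → proj i [ xs ]⇓ lookup xs i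
    ev-comp : ∀ {m n} {f : PR m} {gs : Vec (PR n) m} {xs ys v} →
              gs [ xs ]⇓* ys → f [ ys ]⇓ v → comp f gs [ xs ]⇓ v
    ev-prec0 : ∀ {n} {g : PR n} {h : PR (suc (suc n))} {xs v} →
               g [ xs ]⇓ v → prec g h [ 0 ∷ xs ]⇓ v
    ev-precS : ∀ {n} {g : PR n} {h : PR (suc (suc n))} {y xs r v} →
               prec g h [ y ∷ xs ]⇓ r → h [ y ∷ r ∷ xs ]⇓ v →
               prec g h [ suc y ∷ xs ]⇓ v
    ev-mu   : ∀ {n} {f : PR (suc n)} {xs y} →
              f [ y ∷ xs ]⇓ 0 →
              (∀ z → z < y → Σ ℕ (λ k → f [ z ∷ xs ]⇓ suc k)) →
              mu f [ xs ]⇓ y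

  data _[_]⇓*_ : ∀ {m n} → Vec (PR n) m → Vec ℕ n → Vec ℕ m → Set where
    []  : ∀ {n} {xs : Vec ℕ n} → [] [ xs ]⇓* []
    _∷_ : ∀ {m n} {g : PR n} {gs : Vec (PR n) m} {xs y ys} →
          g [ xs ]⇓ y → gs [ xs ]⇓* ys → (g ∷ gs) [ xs ]⇓* (y ∷ ys)

Halts : ∀ {n} → PR n → Vec ℕ n → Set
Halts f xs = Σ ℕ (λ v → f [ xs ]⇓ v)

_⇔_ : Set → Set → Set
A ⇔ B = (A → B) × (B → A)

IsCE : (ℕ → ℕ → Set) → Set
IsCE R = Σ (PR 2) (λ e → ∀ x y → R x y ⇔ Halts e (x ∷ y ∷ []))

IsCoCE : (ℕ → ℕ → Set) → Set
IsCoCE R = Σ (PR 2) (λ e → ∀ x y → (¬ R x y) ⇔ Halts e (x ∷ y ∷ []))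

IsCongruence : (E ε : ℕ → ℕ → Set) → Set
IsCongruence E ε = ∀ {x x' y y'} → E x x' → E y y' → ε x y ⇔ ε x' y'

-- First-order language of set theory {∈, =}, de Bruijn variables

infixr 6 _∧'_
data Formula : Set where
  _∈'_ : ℕ → ℕ → Formula
  _≐_  : ℕ → ℕ → Formula
  ¬'_  : Formula → Formula
  _∧'_ : Formula → Formula → Formula
  ∀'_  : Formula → Formula
  ∀∈   : ℕ → Formula → Formula        -- ∀∈ i φ : ∀ x ∈ vᵢ. φ  (i in outer context)

∃'_ : Formula → Formula
∃' φ = ¬' (∀' (¬' φ))

∃∈ : ℕ → Formula → Formula
∃∈ i φ = ¬' (∀∈ i (¬' φ))

_∨'_ : Formula → Formula → Formula
φ ∨' ψ = ¬' ((¬' φ) ∧' (¬' ψ))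

_⇒'_ : Formula → Formula → Formula
φ ⇒' ψ = ¬' (φ ∧' (¬' ψ))

_⇔'_ : Formula → Formula → Formula
φ ⇔' ψ = (φ ⇒' ψ) ∧' (ψ ⇒' φ)

data IsΔ₀ : Formula → Set where
  mem : ∀ {i j} → IsΔ₀ (i ∈' j)
  eq  : ∀ {i j} → IsΔ₀ (i ≐ j)
  neg : ∀ {φ} → IsΔ₀ φ → IsΔ₀ (¬' φ)
  con : ∀ {φ ψ} → IsΔ₀ φ → IsΔ₀ ψ → IsΔ₀ (φ ∧' ψ)
  bnd : ∀ {i φ} → IsΔ₀ φ → IsΔ₀ (∀∈ i φ)

ext : (ℕ → ℕ) → ℕ → ℕ
ext r zero    = zero
ext r (suc n) = suc (r n)

ren : (ℕ → ℕ) → Formula → Formula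
ren r (i ∈' j)  = r i ∈' r j
ren r (i ≐ j)   = r i ≐ r j
ren r (¬' φ)    = ¬' ren r φ
ren r (φ ∧' ψ)  = ren r φ ∧' ren r ψ
ren r (∀' φ)    = ∀' ren (ext r) φ
ren r (∀∈ i φ)  = ∀∈ (r i) (ren (ext r) φ)

-- Tarski semantics in the structure ⟨ℕ, ε⟩/E.  The quotient is represented
-- by interpreting equality as E (E is a congruence for ε).  Atoms are
-- double-negated so that satisfaction is the classical one (Gödel–Gentzen).

_∷ₑ_ : ℕ → (ℕ → ℕ) → ℕ → ℕ
(a ∷ₑ ρ) zero    = a
(a ∷ₑ ρ) (suc n) = ρ n

Sat : (ε E : ℕ → ℕ → Set) → Formula → (ℕ → ℕ) → Set
Sat ε E (i ∈' j) ρ = ¬ ¬ ε (ρ i) (ρ j)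
Sat ε E (i ≐ j)  ρ = ¬ ¬ E (ρ i) (ρ j)
Sat ε E (¬' φ)   ρ = ¬ Sat ε E φ ρ
Sat ε E (φ ∧' ψ) ρ = Sat ε E φ ρ × Sat ε E ψ ρ
Sat ε E (∀' φ)   ρ = (a : ℕ) → Sat ε E φ (a ∷ₑ ρ)
Sat ε E (∀∈ i φ) ρ = (a : ℕ) → ¬ ¬ ε a (ρ i) → Sat ε E φ (a ∷ₑ ρ)

Valid : (ε E : ℕ → ℕ → Set) → Formula → Set
Valid ε E φ = (ρ : ℕ → ℕ) → Sat ε E φ ρ

Extensionality : Formula
Extensionality = ∀' ∀' ((∀' ((0 ∈' 2) ⇔' (0 ∈' 1))) ⇒' (1 ≐ 0))

Pairing : Formula
Pairing = ∀' ∀' ∃' ((2 ∈' 0) ∧' (1 ∈' 0))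

Union : Formula
Union = ∀' ∃' (∀∈ 1 (∀∈ 0 (0 ∈' 2)))

Infinity : Formula
Infinity = ∃' ((∃∈ 0 (∀' (¬' (0 ∈' 1))))
               ∧' ∀∈ 0 (∃∈ 1 ((1 ∈' 0)
                               ∧' ∀∈ 1 (0 ∈' 1)
                               ∧' ∀∈ 0 ((0 ∈' 2) ∨' (0 ≐ 2)))))

-- Δ₀-separation for φ with variable 0 = x, 1 = a, 2+k = parameters:
-- ∀a ∃b ∀x (x ∈ b ↔ x ∈ a ∧ φ)
sepRen : ℕ → ℕ
sepRen zero          = 0
sepRen (suc zero)    = 2
sepRen (suc (suc k)) = suc (suc (suc k))

Separation : Formula → Formula
Separation φ = ∀' ∃' ∀' ((0 ∈' 1) ⇔' ((0 ∈' 2) ∧' ren sepRen φ))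

-- Δ₀-collection for φ with variable 0 = y, 1 = x, 2 = a, 3+k = parameters:
-- ∀a (∀x∈a ∃y φ → ∃b ∀x∈a ∃y∈b φ)
colRen : ℕ → ℕ
colRen zero                = 0
colRen (suc zero)          = 1
colRen (suc (suc zero))    = 3
colRen (suc (suc (suc k))) = suc (suc (suc (suc k)))

Collection : Formula → Formula
Collection φ = ∀' ((∀∈ 0 (∃' φ)) ⇒' (∃' (∀∈ 1 (∃∈ 1 (ren colRen φ)))))

-- foundation schema for φ with variable 0 = x, 1+k = parameters:
-- ∃x φ(x) → ∃x (φ(x) ∧ ∀y∈x ¬φ(y))
fndRen : ℕ → ℕ
fndRen zero    = 0
fndRen (suc k) = suc (suc k)

Foundation : Formula → Formula
Foundation φ = (∃' φ) ⇒' (∃' (φ ∧' ∀∈ 0 (¬' ren fndRen φ)))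

record ModelOfKP (ε E : ℕ → ℕ → Set) : Set where
  field
    extensionality : Valid ε E Extensionality
    pairing        : Valid ε E Pairing
    union          : Valid ε E Union
    infinity       : Valid ε E Infinity
    separation     : ∀ φ → IsΔ₀ φ → Valid ε E (Separation φ)
    collection     : ∀ φ → IsΔ₀ φ → Valid ε E (Collection φ)
    foundation     : ∀ φ → Valid ε E (Foundation φ)

{-# OPTIONS --safe #-}

-- Work with the Zermelo numerals 0 = ∅, n + 1 = {n} of the model, and let Z be
-- a set of the model that contains all standard numerals and whose elements
-- have at most one element.  A representative of n + 1 is found from a
-- representative r of n by searching for r' with r ε r' and r' ε Z; since ε is
-- c.e., membership of a numeral in a set of the model is c.e. uniformly in the
-- set.  Conversely the model represents primitive recursive functions, by Δ₀
-- formulas whose quantifiers are bounded by a set V containing all standard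
-- hereditarily finite sets.  Applied to the search for a certificate that n
-- belongs, or does not belong, to the set coded by n itself, this gives a set S
-- and its complement T in V such that a suitable combination n of S and T is
-- diagonal: the first certificate for n contradicts the definition of S.
--
-- Since satisfaction is double-negated, everything about the model is proved in
-- the double-negation monad.

module Submission where

open import Defs
open import Defs using () renaming (_∷ₑ_ to infixr 5 _◂_)
open import Data.Nat using (ℕ; zero; suc; _+_; _≤_; _<_; _⊔_; z≤n; s≤s)
open import Data.Nat.Properties using
  (≤-trans; ≤-refl; m≤m⊔n; m≤n⊔m; <⇒≤; m≤n⇒m<n∨m≡n; m≤n⇒m≤1+n; +-assoc)
open import Data.Vec using (Vec; []; _∷_; lookup; map)
open import Data.Vec.Properties using (∷-injectiveˡ; ∷-injectiveʳ; lookup-map; map-∘; map-cong)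
open import Data.Product using (Σ; _×_; _,_; proj₁; proj₂)
open import Data.Sum using (_⊎_; inj₁; inj₂)
open import Data.Empty using (⊥; ⊥-elim)
open import Data.Unit using (⊤; tt)
open import Function using (_∘_; id; it; case_of_)
open import Relation.Nullary using (¬_)
open import Relation.Binary.Structures using (IsEquivalence)
open import Relation.Binary.PropositionalEquality using (_≡_; refl; sym; trans; cong; cong₂; subst)

-- Primitive recursive terms and clocked simulation.

data Tm : Set where
  var : ℕ → Tm
  ze  : Tm
  su  : Tm → Tm
  rec : Tm → Tm → Tm → Tm
  -- Evaluates a term in an environment that remembers only three variables, so
  -- that its value cannot depend on anything else.
  at  : Tm → ℕ → ℕ → ℕ → Tm

natrec : ℕ → (ℕ → ℕ → ℕ) → ℕ → ℕ
natrec b s zero    = b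
natrec b s (suc n) = s n (natrec b s n)

eval : Tm → (ℕ → ℕ) → ℕ
eval (var i)     γ = γ i
eval ze          γ = 0
eval (su t)      γ = suc (eval t γ)
eval (rec t b s) γ = natrec (eval b γ) (λ i a → eval s (a ◂ i ◂ γ)) (eval t γ)
eval (at t i j k) γ = eval t (γ i ◂ γ j ◂ γ k ◂ λ _ → γ k)

-- Simulation with the clock in variable k and the inputs in the variables is: the
-- value is suc v if the result v is found in time, and 0 otherwise.
mutual
  sim : ∀ {n} → PR n → ℕ → Vec ℕ n → Tm
  sim zer         k is       = su ze
  sim succ        k (i ∷ []) = su (su (var i))
  sim (proj j)    k is       = su (var (lookup is j))
  sim (comp f gs) k is       = sims gs k is (λ d js → sim f (d + k) js)
  sim (prec g h)  k (i ∷ is) =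
    rec (var i) (sim g k is) (rec (var 0) ze (sim h (4 + k) (3 ∷ 1 ∷ map (4 +_) is)))
  sim (mu f)      k is       = rec (rec (var k) ze (muStep f k is)) ze (var 1)

  -- The state is 0 while searching, 1 when stuck, and 2 + y when y is found.
  muStep : ∀ {n} → PR (suc n) → ℕ → Vec ℕ n → Tm
  muStep f k is =
    rec (var 0)
        (rec (sim f (2 + k) (1 ∷ map (2 +_) is)) (su ze) (rec (var 1) (su (su (var 3))) ze))
        (su (var 1))

  -- In continuation-passing style: `c` receives the number `d` of variables pushed by the call and
  -- the variables that hold the results.
  sims : ∀ {m n} → Vec (PR n) m → ℕ → Vec ℕ n → (ℕ → Vec ℕ m → Tm) → Tm
  sims []       k is c = c 0 []
  sims (g ∷ gs) k is c =
    rec (sim g k is) ze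
        (sims gs (2 + k) (map (2 +_) is) (λ d js → c (d + 2) (d + 1 ∷ js)))

-- `rec t ze u` is the bind of the option coding: 0 is failure, and on success variable 1 of `u`,
-- the predecessor of the value of `t`, is the result.
rec-ze-suc : ∀ t u γ {v} → eval (rec t ze u) γ ≡ suc v →
  Σ ℕ λ y → Σ ℕ λ a → eval t γ ≡ suc y × eval u (a ◂ y ◂ γ) ≡ suc v
rec-ze-suc t u γ e with eval t γ
... | suc y = y , _ , refl , e

natrec-suc : ∀ {b s r y v} → r ≡ suc y → (∀ a → s y a ≡ v) → natrec b s r ≡ v
natrec-suc refl h = h _

map-shift : ∀ {n} (γ' γ : ℕ → ℕ) d → (∀ i → γ' (d + i) ≡ γ i) → (is : Vec ℕ n) →
  map γ' (map (d +_) is) ≡ map γ is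
map-shift γ' γ d h is = trans (sym (map-∘ γ' (d +_) is)) (map-cong h is)

-- Soundness of the simulation.

muState : ∀ {n} → PR (suc n) → ℕ → Vec ℕ n → (ℕ → ℕ) → ℕ → ℕ
muState f k is γ = natrec 0 (λ i a → eval (muStep f k is) (a ◂ i ◂ γ))

precLoop : ∀ {n} → PR n → PR (suc (suc n)) → ℕ → Vec ℕ n → (ℕ → ℕ) → ℕ → ℕ
precLoop g h k is γ =
  natrec (eval (sim g k is) γ)
    (λ i a → eval (rec (var 0) ze (sim h (4 + k) (3 ∷ 1 ∷ map (4 +_) is))) (a ◂ i ◂ γ))

mutual
  sim-sound : ∀ {n} (f : PR n) k is γ {v} → eval (sim f k is) γ ≡ suc v → f [ map γ is ]⇓ v
  sim-sound zer k is γ refl = ev-zer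
  sim-sound succ k (i ∷ []) γ refl = ev-succ
  sim-sound (proj j) k is γ refl =
    subst (proj j [ map γ is ]⇓_) (lookup-map j γ is) ev-proj
  sim-sound (comp f gs) k is γ e
    with sims-sound gs k is (λ d js → sim f (d + k) js) γ e
  ... | d , js , γ' , h , evs , e' = ev-comp evs (sim-sound f (d + k) js γ' e')
  sim-sound (prec g h) k (i ∷ is) γ e = loop (γ i) e
    where
    loop : ∀ N {v} → precLoop g h k is γ N ≡ suc v → prec g h [ N ∷ map γ is ]⇓ v
    loop zero e = ev-prec0 (sim-sound g k is γ e)
    loop (suc N) {v} e
      with rec-ze-suc (var 0) (sim h (4 + k) (3 ∷ 1 ∷ map (4 +_) is)) (precLoop g h k is γ N ◂ N ◂ γ) e
    ... | y , _ , eq₁ , eq₂ = ev-precS (loop N eq₁)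
      (subst (λ ys → h [ N ∷ y ∷ ys ]⇓ v) (map-shift _ γ 4 (λ _ → refl) is)
        (sim-sound h (4 + k) (3 ∷ 1 ∷ map (4 +_) is) _ eq₂))
  sim-sound (mu f) k is γ e with rec-ze-suc (rec (var k) ze (muStep f k is)) (var 1) γ e
  ... | y , _ , eq₁ , refl with mu-sound f k is γ (γ k)
  ... | search , found = let p , q = found eq₁ in ev-mu p q

  -- The loop invariant of the search. The first half supplies, at the moment a zero is found, that
  -- all earlier values were positive; the stuck state satisfies both halves vacuously.
  mu-sound : ∀ {n} (f : PR (suc n)) k is γ j →
    (muState f k is γ j ≡ 0 → ∀ z → z < j → Σ ℕ λ q → f [ z ∷ map γ is ]⇓ suc q) ×
    (∀ {y} → muState f k is γ j ≡ suc (suc y) →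
      f [ y ∷ map γ is ]⇓ 0 × (∀ z → z < y → Σ ℕ λ q → f [ z ∷ map γ is ]⇓ suc q))
  mu-sound f k is γ zero = (λ _ _ ()) , λ ()
  mu-sound f k is γ (suc j) with muState f k is γ j | mu-sound f k is γ j
  ... | suc _ | _ , found = (λ ()) , λ { refl → found refl }
  ... | zero | search , _
    with eval (sim f (2 + k) (1 ∷ map (2 +_) is)) (0 ◂ j ◂ γ)
       | sim-sound f (2 + k) (1 ∷ map (2 +_) is) (0 ◂ j ◂ γ)
  ... | zero | _ = (λ ()) , λ ()
  ... | suc zero | snd = (λ ()) , λ { refl →
      subst (λ ys → f [ j ∷ ys ]⇓ 0) (map-shift _ γ 2 (λ _ → refl) is) (snd refl) , search refl }
  ... | suc (suc q) | snd = (λ _ → next) , λ ()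
    where
    next : ∀ z → z < suc j → Σ ℕ λ q → f [ z ∷ map γ is ]⇓ suc q
    next z (s≤s z≤j) with m≤n⇒m<n∨m≡n z≤j
    ... | inj₁ z<j = search refl z z<j
    ... | inj₂ refl = q ,
      subst (λ ys → f [ j ∷ ys ]⇓ suc q) (map-shift _ γ 2 (λ _ → refl) is) (snd refl)

  sims-sound : ∀ {m n} (gs : Vec (PR n) m) k is c γ {v} → eval (sims gs k is c) γ ≡ suc v →
    Σ ℕ λ d → Σ (Vec ℕ m) λ js → Σ (ℕ → ℕ) λ γ' →
      (∀ i → γ' (d + i) ≡ γ i) × gs [ map γ is ]⇓* map γ' js × eval (c d js) γ' ≡ suc v
  sims-sound [] k is c γ e = 0 , [] , γ , (λ _ → refl) , [] , e
  sims-sound (g ∷ gs) k is c γ e 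
    with rec-ze-suc (sim g k is) (sims gs (2 + k) (map (2 +_) is) _) γ e
  ... | y , _ , eq₁ , eq₂ with sims-sound gs (2 + k) (map (2 +_) is) _ _ eq₂
  ... | d , js , γ' , h , evs , eq₃ =
    d + 2 , d + 1 ∷ js , γ' ,
    (λ i → trans (cong γ' (+-assoc d 2 i)) (h (2 + i))) ,
    subst (g [ map γ is ]⇓_) (sym (h 1)) (sim-sound g k is γ eq₁) ∷
      subst (gs [_]⇓* map γ' js) (map-shift _ γ 2 (λ _ → refl) is) evs ,
    eq₃

-- Completeness of the simulation.

below : ∀ (P : ℕ → ℕ → Set) → (∀ {z K K'} → K ≤ K' → P z K → P z K') →
  ∀ y → (∀ z → z < y → Σ ℕ (P z)) → Σ ℕ λ K → ∀ z → z < y → P z K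
below P up zero    h = 0 , λ _ ()
below P up (suc y) h with below P up y (λ z lt → h z (<⇒≤ (s≤s lt))) | h y ≤-refl
... | K , p | K' , p' = K ⊔ K' , λ { z (s≤s z≤y) → go z (m≤n⇒m<n∨m≡n z≤y) }
  where
  go : ∀ z → z < y ⊎ z ≡ y → P z (K ⊔ K')
  go z (inj₁ lt)   = up (m≤m⊔n K K') (p z lt)
  go z (inj₂ refl) = up (m≤n⊔m K K') p'

-- Uniform in the environment and in the variables for clock and inputs, since simulations are
-- nested under binders that shift all of them.
Bound : ∀ {n} → PR n → Vec ℕ n → ℕ → ℕ → Set
Bound f xs v K = ∀ γ k is → K ≤ γ k → map γ is ≡ xs → eval (sim f k is) γ ≡ suc v

mu-search : ∀ {n} (f : PR (suc n)) k is γ y →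
  (∀ z → z < y → Σ ℕ λ q → ∀ γ' → (∀ i → γ' (2 + i) ≡ γ i) → γ' 1 ≡ z →
    eval (sim f (2 + k) (1 ∷ map (2 +_) is)) γ' ≡ suc (suc q)) →
  ∀ j → j ≤ y → muState f k is γ j ≡ 0
mu-search f k is γ y h zero    _  = refl
mu-search f k is γ y h (suc j) lt with h j lt
... | q , h' = step
  where
  step : muState f k is γ (suc j) ≡ 0
  step rewrite mu-search f k is γ y h j (<⇒≤ lt) | h' (0 ◂ j ◂ γ) (λ _ → refl) refl = refl

mu-found : ∀ {n} (f : PR (suc n)) k is γ y → muState f k is γ y ≡ 0 →
  (∀ γ' → (∀ i → γ' (2 + i) ≡ γ i) → γ' 1 ≡ y →
    eval (sim f (2 + k) (1 ∷ map (2 +_) is)) γ' ≡ 1) →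
  ∀ j → y < j → muState f k is γ j ≡ suc (suc y)
mu-found f k is γ y s h (suc j) (s≤s y≤j) with m≤n⇒m<n∨m≡n y≤j
... | inj₂ refl = step
  where
  step : muState f k is γ (suc j) ≡ suc (suc y)
  step rewrite s | h (0 ◂ y ◂ γ) (λ _ → refl) refl = refl
... | inj₁ y<j = step
  where
  step : muState f k is γ (suc j) ≡ suc (suc y)
  step rewrite mu-found f k is γ y s h j y<j = refl

mutual
  sim-complete : ∀ {n} {f : PR n} {xs v} → f [ xs ]⇓ v → Σ ℕ (Bound f xs v)
  sim-complete ev-zer = 0 , λ _ _ _ _ _ → refl
  sim-complete ev-succ = 0 , λ { γ k (i ∷ []) _ refl → refl }
  sim-complete (ev-proj {i = i}) = 0 , λ { γ k is _ refl → cong suc (sym (lookup-map i γ is)) }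
  sim-complete (ev-comp {f = f} evs ev) with sims-complete evs | sim-complete ev
  ... | K , p | K' , p' = K ⊔ K' , λ γ k is le e →
    p γ k is _ (≤-trans (m≤m⊔n K K') le) e λ γ' d js h e' →
      p' γ' (d + k) js (subst (K' ≤_) (sym (h k)) (≤-trans (m≤n⊔m K K') le)) e'
  sim-complete ev@(ev-prec0 {g = g} {h} _) with prec-complete ev
  ... | K , p = K , λ { γ k (i ∷ is) le e →
    trans (cong (precLoop g h k is γ) (∷-injectiveˡ e)) (p γ k is le (∷-injectiveʳ e)) }
  sim-complete ev@(ev-precS {g = g} {h} _ _) with prec-complete ev
  ... | K , p = K , λ { γ k (i ∷ is) le e →
    trans (cong (precLoop g h k is γ) (∷-injectiveˡ e)) (p γ k is le (∷-injectiveʳ e)) }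
  sim-complete (ev-mu {f = f} {xs} {y} ev evs)
    with sim-complete ev
       | below (λ z K → Σ ℕ λ q → Bound f (z ∷ xs) (suc q) K)
           (λ { le (q , p) → q , λ γ k is le' → p γ k is (≤-trans le le') }) y
           (λ z lt → let K , p = sim-complete (proj₂ (evs z lt)) in K , proj₁ (evs z lt) , p)
  -- The clock also counts the rounds of the search, so it must exceed `y`.
  ... | K₁ , p₁ | K₂ , p₂ = suc y ⊔ (K₁ ⊔ K₂) , λ γ k is le e →
    let le' = ≤-trans (m≤n⊔m (suc y) _) le
        args : ∀ γ' → (∀ i → γ' (2 + i) ≡ γ i) → ∀ {z} → γ' 1 ≡ z →
               map γ' (1 ∷ map (2 +_) is) ≡ z ∷ xs
        args = λ γ' h e' → cong₂ _∷_ e' (trans (map-shift γ' γ 2 h is) e)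
        clock : ∀ {K} γ' → (∀ i → γ' (2 + i) ≡ γ i) → K ≤ γ k → K ≤ γ' (2 + k)
        clock = λ γ' h l → subst (_ ≤_) (sym (h k)) l
    in natrec-suc
         (mu-found f k is γ y
           (mu-search f k is γ y
             (λ z lt → proj₁ (p₂ z lt) , λ γ' h e' →
               proj₂ (p₂ z lt) γ' (2 + k) _
                 (clock γ' h (≤-trans (m≤n⊔m K₁ K₂) le')) (args γ' h e'))
             y ≤-refl)
           (λ γ' h e' → p₁ γ' (2 + k) _ (clock γ' h (≤-trans (m≤m⊔n K₁ K₂) le')) (args γ' h e'))
           (γ k) (≤-trans (m≤m⊔n (suc y) (K₁ ⊔ K₂)) le))
         (λ _ → refl)

  prec-complete : ∀ {n} {g : PR n} {h y xs v} → prec g h [ y ∷ xs ]⇓ v →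
    Σ ℕ λ K → ∀ γ k is → K ≤ γ k → map γ is ≡ xs → precLoop g h k is γ y ≡ suc v
  prec-complete (ev-prec0 ev) = sim-complete ev
  prec-complete (ev-precS {y = y} {r = r} ev ev') with prec-complete ev | sim-complete ev'
  ... | K , p | K' , p' = K ⊔ K' , λ γ k is le e →
    natrec-suc (p γ k is (≤-trans (m≤m⊔n K K') le) e)
      (λ a → p' _ (4 + k) _ (≤-trans (m≤n⊔m K K') le)
        (cong (λ zs → y ∷ r ∷ zs) (trans (map-shift _ γ 4 (λ _ → refl) is) e)))

  sims-complete : ∀ {m n} {gs : Vec (PR n) m} {xs ys} → gs [ xs ]⇓* ys →
    Σ ℕ λ K → ∀ γ k is c {v} → K ≤ γ k → map γ is ≡ xs →
      (∀ γ' d js → (∀ i → γ' (d + i) ≡ γ i) → map γ' js ≡ ys → eval (c d js) γ' ≡ suc v) →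
      eval (sims gs k is c) γ ≡ suc v
  sims-complete [] = 0 , λ γ k is c _ _ h → h γ 0 [] (λ _ → refl) refl
  sims-complete (ev ∷ evs) with sim-complete ev | sims-complete evs
  ... | K , p | K' , p' = K ⊔ K' , λ γ k is c le e h →
    natrec-suc (p γ k is (≤-trans (m≤m⊔n K K') le) e)
      (λ a → p' _ (2 + k) _ _ (≤-trans (m≤n⊔m K K') le)
        (trans (map-shift _ γ 2 (λ _ → refl) is) e)
        (λ γ' d js h' e' → h γ' (d + 2) (d + 1 ∷ js)
          (λ i → trans (cong γ' (+-assoc d 2 i)) (h' (2 + i)))
          (cong₂ _∷_ (h' 1) e')))

-- Bounded search.

guard : ℕ → ℕ → ℕ
guard t u = natrec 0 (λ _ _ → u) t

-- A nonzero accumulator is kept, so the first hit wins and remains the result for every larger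
-- bound.
bfind : (ℕ → ℕ) → ℕ → ℕ
bfind p = natrec 0 (λ i a → natrec (p i) (λ b _ → suc b) a)

guard-suc : ∀ t {u v} → guard t u ≡ suc v → (Σ ℕ λ y → t ≡ suc y) × u ≡ suc v
guard-suc (suc y) e = (y , refl) , e

guard-true : ∀ {t u y} → t ≡ suc y → guard t u ≡ u
guard-true refl = refl

bfind-sound : ∀ p k {v} → bfind p k ≡ suc v → Σ ℕ λ i → i < k × p i ≡ suc v
bfind-sound p (suc k) e with bfind p k | bfind-sound p k
... | zero  | _ = k , ≤-refl , e
... | suc a | h with h refl
...   | i , lt , e' = i , m≤n⇒m≤1+n lt , trans e' e

bfind-step : ∀ p k {v} → bfind p k ≡ suc v → bfind p (suc k) ≡ suc v
bfind-step p k e rewrite e = refl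

bfind-stable : ∀ p {k k' v} → k ≤ k' → bfind p k ≡ suc v → bfind p k' ≡ suc v
bfind-stable p {k' = zero}   z≤n e = e
bfind-stable p {k' = suc k'} le  e with m≤n⇒m<n∨m≡n le
... | inj₁ (s≤s le') = bfind-step p k' (bfind-stable p le' e)
... | inj₂ refl = e

bfind-complete : ∀ p {i k v} → i < k → p i ≡ suc v → Σ ℕ λ v' → bfind p k ≡ suc v'
bfind-complete p {i} lt e =
  let v' , e' = here (bfind p i) refl in v' , bfind-stable p lt e'
  where
  here : ∀ a → bfind p i ≡ a → Σ ℕ λ v' → bfind p (suc i) ≡ suc v'
  here zero    h rewrite h = _ , e
  here (suc a) h = a , bfind-step p i h

Least : (ℕ → ℕ) → Set
Least f = Σ ℕ λ k₀ → Σ ℕ (λ v → f k₀ ≡ suc v) × (∀ k → k < k₀ → f k ≡ 0)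

least-or-zero : ∀ f n → Least f ⊎ (∀ k → k < n → f k ≡ 0)
least-or-zero f zero = inj₂ λ _ ()
least-or-zero f (suc n) with least-or-zero f n
... | inj₁ l = inj₁ l
... | inj₂ h with f n in e
...   | suc v = inj₁ (n , (v , e) , h)
...   | zero  = inj₂ λ { k (s≤s le) → extend k (m≤n⇒m<n∨m≡n le) }
  where
  extend : ∀ k → k < n ⊎ k ≡ n → f k ≡ 0
  extend k (inj₁ lt)   = h k lt
  extend k (inj₂ refl) = e

least : ∀ f k {v} → f k ≡ suc v → Least f
least f k e with least-or-zero f (suc k)
... | inj₁ l = l
... | inj₂ h with trans (sym e) (h k ≤-refl)
...   | ()

findT : ℕ → Tm → Tm
findT k p = rec (var k) ze (rec (var 0) p (su (var 1)))

-- The certificate term.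

module Certificates (e : PR 2) where

  -- Arguments: clock, x, y.
  haltT : ℕ → ℕ → ℕ → Tm
  haltT = at (sim e 0 (1 ∷ 2 ∷ []))

  -- Variables: n, k, z, Z, m.
  numeralT : Tm
  numeralT = rec (var 0) (su (var 2)) (rec (var 0) ze
    (findT 5 (findT 1 (rec (haltT 3 5 1) ze (rec (haltT 5 3 13) ze (su (var 5)))))))

  -- Value 2: the numeral of `n` is seen to lie in the set coded by `n`. Value 1: it is seen to lie
  -- in an element of that set that contains the marker `m`. Value 0: neither is seen by time `k`.
  certT : Tm
  certT = rec numeralT ze (rec (haltT 3 1 2)
    (findT 3 (rec (haltT 5 1 4) ze (rec (haltT 7 10 3) ze (rec (haltT 9 7 5) ze (su ze)))))
    (su (su ze)))

  halt : ℕ → ℕ → ℕ → ℕ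
  halt c x y = eval (sim e 0 (1 ∷ 2 ∷ [])) (c ◂ x ◂ y ◂ λ _ → y)

  halt-sound : ∀ {c x y v} → halt c x y ≡ suc v → Halts e (x ∷ y ∷ [])
  halt-sound h = _ , sim-sound e 0 (1 ∷ 2 ∷ []) _ h

  halt-complete : ∀ {x y} → Halts e (x ∷ y ∷ []) →
    Σ ℕ λ K → Σ ℕ λ v → ∀ c → K ≤ c → halt c x y ≡ suc v
  halt-complete (v , ev) with sim-complete ev
  ... | K , p = K , v , λ c le → p _ 0 (1 ∷ 2 ∷ []) le refl

  module Values (z Z m : ℕ) where

    next : ℕ → ℕ → ℕ → ℕ
    next r c r' = guard (halt c r r') (guard (halt c r' Z) (suc r'))

    -- The inner search runs with clock `c` instead of `k`, so the first successful `c`, and with it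
    -- the representative found, is the same for all large `k`.
    numeral : ℕ → ℕ → ℕ
    numeral k =
      natrec (suc z) (λ _ a → natrec 0 (λ r _ → bfind (λ c → bfind (next r c) c) k) a)

    cert₁ : ℕ → ℕ → ℕ → ℕ → ℕ
    cert₁ n k r q = guard (halt k q n) (guard (halt k m q) (guard (halt k r q) 1))

    -- Definitionally the value of certT on (n, k, z, Z, m, m, …).
    cert : ℕ → ℕ → ℕ
    cert n k = natrec 0
      (λ r _ → natrec (bfind (cert₁ n k r) k) (λ _ _ → 2) (halt k r n)) (numeral k n)

-- The double-negation monad.

infixl 1 _>>=_
-- The target may be any negation, so this also proves negative statements directly.
_>>=_ : {A B : Set} → ¬ ¬ A → (A → ¬ B) → ¬ B
(m >>= f) b = m (λ a → f a b)

return : {A : Set} → A → ¬ ¬ A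
return a k = k a

excluded-middle : (A : Set) → ¬ ¬ (A ⊎ ¬ A)
excluded-middle A k = k (inj₂ (k ∘ inj₁))

-- `Or` and `Imp` are what satisfaction of `_∨'_` and `_⇒'_` unfolds to.
Or : Set → Set → Set
Or A B = ¬ (¬ A × ¬ B)

inl : {A B : Set} → A → Or A B
inl a (na , _) = na a

inr : {A B : Set} → B → Or A B
inr b (_ , nb) = nb b

or-elim : {A B C : Set} → Or A B → (A → ¬ C) → (B → ¬ C) → ¬ C
or-elim o f g c = o ((λ a → f a c) , (λ b → g b c))

Imp : Set → Set → Set
Imp A B = ¬ (A × ¬ B)

imp-intro : {A B : Set} → (A → ¬ ¬ B) → Imp A B
imp-intro f (a , nb) = f a nb

imp-elim : {A B : Set} → Imp A B → A → ¬ ¬ B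
imp-elim f a nb = f (a , nb)

-- Bounded formulas for finite sets and pairs.

emptyF : ℕ → Formula
emptyF i = ∀∈ i (¬' (0 ∈' suc i))

singF : ℕ → ℕ → Formula
singF q a = (a ∈' q) ∧' ∀∈ q (0 ≐ suc a)

doubF : ℕ → ℕ → ℕ → Formula
doubF q a b = (a ∈' q) ∧' (b ∈' q) ∧' ∀∈ q ((0 ≐ suc a) ∨' (0 ≐ suc b))

-- Adjunction: `q` = `u` ∪ {`v`}.
adjF : ℕ → ℕ → ℕ → Formula
adjF q u v = ∀∈ u (0 ∈' suc q) ∧' (v ∈' q) ∧' ∀∈ q ((0 ∈' suc u) ∨' (0 ≐ suc v))

-- The Kuratowski pair {{`a`}, {`a`, `b`}}.
pairF : ℕ → ℕ → ℕ → Formula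
pairF p a b =
  ∃∈ p (singF 0 (suc a)) ∧' ∃∈ p (doubF 0 (suc a) (suc b)) ∧'
  ∀∈ p (singF 0 (suc a) ∨' doubF 0 (suc a) (suc b))

instance
  Δ₀-mem : ∀ {i j} → IsΔ₀ (i ∈' j)
  Δ₀-mem = mem
  Δ₀-eq : ∀ {i j} → IsΔ₀ (i ≐ j)
  Δ₀-eq = eq
  Δ₀-neg : ∀ {φ} → {{IsΔ₀ φ}} → IsΔ₀ (¬' φ)
  Δ₀-neg {{d}} = neg d
  Δ₀-con : ∀ {φ ψ} → {{IsΔ₀ φ}} → {{IsΔ₀ ψ}} → IsΔ₀ (φ ∧' ψ)
  Δ₀-con {{d}} {{e}} = con d e
  Δ₀-bnd : ∀ {i φ} → {{IsΔ₀ φ}} → IsΔ₀ (∀∈ i φ)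
  Δ₀-bnd {{d}} = bnd d

-- Satisfaction modulo `E`.

module Structure (ε E : ℕ → ℕ → Set) (eqv : IsEquivalence E) (congr : IsCongruence E ε) where

  infix 4 _∈_ _≈_
  _∈_ _≈_ : ℕ → ℕ → Set
  x ∈ y = ¬ ¬ ε x y
  x ≈ y = ¬ ¬ E x y

  ⟦_⟧ : Formula → (ℕ → ℕ) → Set
  ⟦_⟧ = Sat ε E

  ≈-refl : ∀ {x} → x ≈ x
  ≈-refl = return (IsEquivalence.refl eqv)

  ≈-sym : ∀ {x y} → x ≈ y → y ≈ x
  ≈-sym p = p >>= λ e → return (IsEquivalence.sym eqv e)

  ≈-trans : ∀ {x y z} → x ≈ y → y ≈ z → x ≈ z
  ≈-trans p q = p >>= λ e → q >>= λ f → return (IsEquivalence.trans eqv e f)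

  ∈-resp : ∀ {x x' y y'} → x ≈ x' → y ≈ y' → x ∈ y → x' ∈ y'
  ∈-resp p q m = p >>= λ e → q >>= λ f → m >>= λ h → return (proj₁ (congr e f) h)

  ∈-respˡ : ∀ {x x' y} → x ≈ x' → x ∈ y → x' ∈ y
  ∈-respˡ p = ∈-resp p ≈-refl

  ∈-respʳ : ∀ {x y y'} → y ≈ y' → x ∈ y → x ∈ y'
  ∈-respʳ = ∈-resp ≈-refl

  Sat-stable : ∀ φ {ρ} → ¬ ¬ ⟦ φ ⟧ ρ → ⟦ φ ⟧ ρ
  Sat-stable (i ∈' j) nn = nn >>= id
  Sat-stable (i ≐ j)  nn = nn >>= id
  Sat-stable (¬' φ)   nn = nn >>= id
  Sat-stable (φ ∧' ψ) nn =
    Sat-stable φ (nn >>= λ s → return (proj₁ s)) , Sat-stable ψ (nn >>= λ s → return (proj₂ s))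
  Sat-stable (∀' φ)   nn a = Sat-stable φ (nn >>= λ s → return (s a))
  Sat-stable (∀∈ i φ) nn a m = Sat-stable φ (nn >>= λ s → return (s a m))

  ≈-push : ∀ {ρ ρ' : ℕ → ℕ} {a} → (∀ i → ρ i ≈ ρ' i) → ∀ i → (a ◂ ρ) i ≈ (a ◂ ρ') i
  ≈-push h zero    = ≈-refl
  ≈-push h (suc i) = h i

  Sat-≈ : ∀ φ {ρ ρ'} → (∀ i → ρ i ≈ ρ' i) → ⟦ φ ⟧ ρ → ⟦ φ ⟧ ρ'
  Sat-≈ (i ∈' j) h s = ∈-resp (h i) (h j) s
  Sat-≈ (i ≐ j)  h s = ≈-trans (≈-sym (h i)) (≈-trans s (h j))
  Sat-≈ (¬' φ)   h s s' = s (Sat-≈ φ (≈-sym ∘ h) s')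
  Sat-≈ (φ ∧' ψ) h (s , s') = Sat-≈ φ h s , Sat-≈ ψ h s'
  Sat-≈ (∀' φ)   h s a = Sat-≈ φ (≈-push h) (s a)
  Sat-≈ (∀∈ i φ) h s a m = Sat-≈ φ (≈-push h) (s a (∈-respʳ (≈-sym (h i)) m))

  Sat-ren : ∀ φ {r ρ ρ'} → (∀ i → ρ (r i) ≡ ρ' i) →
    (⟦ ren r φ ⟧ ρ → ⟦ φ ⟧ ρ') × (⟦ φ ⟧ ρ' → ⟦ ren r φ ⟧ ρ)
  Sat-ren (i ∈' j) h rewrite h i | h j = id , id
  Sat-ren (i ≐ j)  h rewrite h i | h j = id , id
  Sat-ren (¬' φ)   h with Sat-ren φ h
  ... | f , g = (λ s → s ∘ g) , (λ s → s ∘ f)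
  Sat-ren (φ ∧' ψ) h with Sat-ren φ h | Sat-ren ψ h
  ... | f , g | f' , g' = (λ (s , s') → f s , f' s') , (λ (s , s') → g s , g' s')
  Sat-ren (∀' φ) {r} {ρ} {ρ'} h =
    (λ s a → proj₁ (body a) (s a)) , (λ s a → proj₂ (body a) (s a))
    where
    body : ∀ a → (⟦ ren (ext r) φ ⟧ (a ◂ ρ) → ⟦ φ ⟧ (a ◂ ρ')) ×
                 (⟦ φ ⟧ (a ◂ ρ') → ⟦ ren (ext r) φ ⟧ (a ◂ ρ))
    body a = Sat-ren φ λ { zero → refl ; (suc i) → h i }
  Sat-ren (∀∈ i φ) {r} {ρ} {ρ'} h rewrite h i =
    (λ s a m → proj₁ (body a) (s a m)) , (λ s a m → proj₂ (body a) (s a m))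
    where
    body : ∀ a → (⟦ ren (ext r) φ ⟧ (a ◂ ρ) → ⟦ φ ⟧ (a ◂ ρ')) ×
                 (⟦ φ ⟧ (a ◂ ρ') → ⟦ ren (ext r) φ ⟧ (a ◂ ρ))
    body a = Sat-ren φ λ { zero → refl ; (suc i) → h i }

  -- Satisfaction of `∃∈` unfolds to this. The predicates below likewise unfold from their formulas,
  -- so `Sat-≈` shows that they respect `_≈_`.
  Ex : ℕ → (ℕ → Set) → Set
  Ex b P = ¬ (∀ a → a ∈ b → ¬ P a)

  ex-intro : ∀ {b} {P : ℕ → Set} a → a ∈ b → P a → Ex b P
  ex-intro a m p k = k a m p

  ex-elim : ∀ {b} {P : ℕ → Set} → Ex b P → ¬ ¬ (Σ ℕ λ a → a ∈ b × P a)
  ex-elim e k = e λ a m p → k (a , m , p)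

  -- The language has no falsum, hence the repeated membership.
  Empty : ℕ → Set
  Empty x = ∀ a → a ∈ x → ¬ (a ∈ x)

  ∉-empty : ∀ {x a} → Empty x → ¬ (a ∈ x)
  ∉-empty h m = h _ m m

  Sing : ℕ → ℕ → Set
  Sing q a = a ∈ q × (∀ t → t ∈ q → t ≈ a)

  Doub : ℕ → ℕ → ℕ → Set
  Doub q a b = a ∈ q × b ∈ q × (∀ t → t ∈ q → Or (t ≈ a) (t ≈ b))

  Adj : ℕ → ℕ → ℕ → Set
  Adj q u v = (∀ t → t ∈ u → t ∈ q) × v ∈ q × (∀ t → t ∈ q → Or (t ∈ u) (t ≈ v))

  Pair : ℕ → ℕ → ℕ → Set
  Pair p a b = Ex p (λ q → Sing q a) × Ex p (λ q → Doub q a b) ×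
    (∀ q → q ∈ p → Or (Sing q a) (Doub q a b))

  env₃ : ∀ {x y z x' y' z'} → x ≈ x' → y ≈ y' → z ≈ z' →
    ∀ i → (x ◂ y ◂ z ◂ id) i ≈ (x' ◂ y' ◂ z' ◂ id) i
  env₃ p q r 0 = p
  env₃ p q r 1 = q
  env₃ p q r 2 = r
  env₃ p q r (suc (suc (suc i))) = ≈-refl

  Sing-resp : ∀ {q q' a a'} → q ≈ q' → a ≈ a' → Sing q a → Sing q' a'
  Sing-resp p r = Sat-≈ (singF 0 1) (env₃ p r (≈-refl {0}))

  Doub-resp : ∀ {q q' a b} → q ≈ q' → Doub q a b → Doub q' a b
  Doub-resp p = Sat-≈ (doubF 0 1 2) (env₃ p ≈-refl ≈-refl)

  Pair-resp : ∀ {p p' a a' b b'} → p ≈ p' → a ≈ a' → b ≈ b' → Pair p a b → Pair p' a' b'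
  Pair-resp p r s = Sat-≈ (pairF 0 1 2) (env₃ p r s)

  -- The element {`a`} of `p` is {`c`} or {`c`, `d`}, and both contain `c`.
  Pair-injˡ : ∀ {p a b c d} → Pair p a b → Pair p c d → a ≈ c
  Pair-injˡ (s , _ , _) (_ , _ , h) = ex-elim s >>= λ (q , m , (_ , sing)) →
    or-elim (h q m) (λ (c∈q , _) → ≈-sym (sing _ c∈q)) (λ (c∈q , _) → ≈-sym (sing _ c∈q))

  -- `b` lies in {`c`} or {`c`, `d`}, so only `b` = `c` needs work. Then `d` lies in {`a`} or {`a`,
  -- `b`}, and `d` = `a` gives `d` = `a` = `c` = `b`.
  Pair-injʳ : ∀ {p a b c d} → Pair p a b → Pair p c d → b ≈ d
  Pair-injʳ {p} {a} {b} {c} {d} P@(_ , D , h) P'@(_ , D' , h') = ex-elim D >>= λ (q , m , (_ , b∈q , _)) →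
    ex-elim D' >>= λ (q' , m' , (_ , d∈q' , _)) →
    or-elim (h' q m) (λ (_ , sing) → finish (sing _ b∈q) q' m' d∈q')
      (λ (_ , _ , doub) → or-elim (doub _ b∈q) (λ b≈c → finish b≈c q' m' d∈q') id)
    where
    finish : b ≈ c → ∀ q' → q' ∈ p → d ∈ q' → b ≈ d
    finish b≈c q' m' d∈q' = or-elim (h q' m') (λ (_ , sing) → d≈a (sing _ d∈q'))
      (λ (_ , _ , doub) → or-elim (doub _ d∈q') d≈a ≈-sym)
      where
      d≈a : d ≈ a → b ≈ d
      d≈a e = ≈-trans b≈c (≈-trans (≈-sym (Pair-injˡ P P')) (≈-sym e))

-- Formulas for the hierarchy and for term values.

levelF : ℕ → ℕ → Formula
levelF a' a = ∀∈ a' (0 ∈' suc a) ∧' ∀∈ a' (∀∈ (suc a') (∃∈ (2 + a) (adjF 0 2 1)))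

-- The level is reached through an element of the pair, which keeps the quantifiers bounded.
belowF : ℕ → ℕ → ℕ → Formula
belowF c z a = ∃∈ c (∃∈ 0 (∃∈ 0 (pairF 2 (3 + z) 0 ∧' levelF 0 (3 + a))))

-- V is obtained from a cumulative hierarchy indexed by sets, which need not be
-- unique: c is coherent if, for each pair ⟨y, a⟩ in c, the level a contains ∅ and,
-- for each z in y, is closed under t = u ∪ {v} for u, v in some level of c with
-- index z.
cohF : ℕ → Formula
cohF c = ∀∈ c (∀∈ 0 (∀∈ 0 (∀∈ 1 (pairF 3 1 0 ⇒'
  (∃∈ 0 (emptyF 0) ∧' ∀∈ 1 (belowF (5 + c) 0 1))))))

goodF : ℕ → ℕ → Formula
goodF c x = cohF c ∧' ∃∈ c (∃∈ 0 (∃∈ 0 (pairF 2 (3 + x) 0)))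

mutual
  -- Formula variable `w` is the numeral of the value of `t`, `v` is the set bounding the
  -- quantifiers, and `r` sends term variables to formula variables.
  repF : Tm → ℕ → ℕ → (ℕ → ℕ) → Formula
  repF (var i)     w v r = w ≐ r i
  repF ze          w v r = emptyF w
  repF (su t)      w v r = ∃∈ v (repF t 0 (suc v) (suc ∘ r) ∧' singF (suc w) 0)
  repF (rec t b s) w v r =
    (w ∈' v) ∧' ∃∈ v (repF t 0 (suc v) (suc ∘ r) ∧'
      ∃∈ (suc v) (∃∈ 0 (pairF 0 2 (3 + w)) ∧' tableF b s 0 (2 + v) ((2 +_) ∘ r)))
  repF (at t i j k) w v r = repF t w v (r i ◂ r j ◂ r k ◂ λ _ → r k)

  -- Each pair in g is the value at 0 or follows from another pair in g by s; g need
  -- not be functional, but at standard arguments it cannot contain wrong values.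
  tableF : Tm → Tm → ℕ → ℕ → (ℕ → ℕ) → Formula
  tableF b s g v r = ∀∈ g (∀∈ (1 + v) (∀∈ (2 + v) (pairF 2 1 0 ⇒'
    ((emptyF 1 ∧' repF b 0 (3 + v) ((3 +_) ∘ r)) ∨'
     ∃∈ (3 + v) (∃∈ (4 + v) (∃∈ (5 + g) (pairF 0 2 1 ∧' singF 4 2 ∧'
       repF s 3 (6 + v) (1 ◂ 2 ◂ (6 +_) ∘ r))))))))

Δ₀-∃∈ : ∀ {i φ} → IsΔ₀ φ → IsΔ₀ (∃∈ i φ)
Δ₀-∃∈ d = neg (bnd (neg d))

Δ₀-∨ : ∀ {φ ψ} → IsΔ₀ φ → IsΔ₀ ψ → IsΔ₀ (φ ∨' ψ)
Δ₀-∨ d e = neg (con (neg d) (neg e))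

Δ₀-⇒ : ∀ {φ ψ} → IsΔ₀ φ → IsΔ₀ ψ → IsΔ₀ (φ ⇒' ψ)
Δ₀-⇒ d e = neg (con d (neg e))

-- Variables: x, V, then the parameters of t from variable 2 on.  The set quantified
-- first is an initial segment of the numerals that can only be left at some k with
-- t(x, k) = 1 (values are at most 2, and 1 is the one that has an empty element);
-- this avoids an order on possibly nonstandard numerals.
searchF : Tm → Formula
searchF t = ∃∈ 1 (∃∈ 0 (emptyF 0) ∧' ∀∈ 0 (∃∈ 3 (
  repF t 0 4 (3 ◂ 1 ◂ (5 +_)) ∧' (∃∈ 0 (emptyF 0) ∨' (emptyF 0 ∧' ∃∈ 2 (singF 0 2))))))

repF-Δ₀ : ∀ t {w v r} → IsΔ₀ (repF t w v r)
repF-Δ₀ (var i)     = it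
repF-Δ₀ ze          = it
repF-Δ₀ (su t)      = Δ₀-∃∈ (con (repF-Δ₀ t) it)
repF-Δ₀ (rec t b s) =
  con it (Δ₀-∃∈ (con (repF-Δ₀ t) (Δ₀-∃∈ (con it (bnd (bnd (bnd (Δ₀-⇒ it (Δ₀-∨
    (con it (repF-Δ₀ b))
    (Δ₀-∃∈ (Δ₀-∃∈ (Δ₀-∃∈ (con it (con it (repF-Δ₀ s)))))))))))))))
repF-Δ₀ (at t i j k) = repF-Δ₀ t

searchF-Δ₀ : ∀ t → IsΔ₀ (searchF t)
searchF-Δ₀ t = Δ₀-∃∈ (con it (bnd (Δ₀-∃∈ (con (repF-Δ₀ t) it))))

-- Elementary set existence in the model.

module Model (ε E : ℕ → ℕ → Set) (eqv : IsEquivalence E) (congr : IsCongruence E ε)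
             (kp : ModelOfKP ε E) where
  open Structure ε E eqv congr
  open ModelOfKP kp

  ext-≈ : ∀ {a b} → (∀ x → x ∈ a → x ∈ b) → (∀ x → x ∈ b → x ∈ a) → a ≈ b
  ext-≈ {a} {b} f g n = extensionality id a b
    ((λ x → imp-intro (λ m → return (f x m)) , imp-intro (λ m → return (g x m))) , λ h → h n)

  sep : ∀ φ {{_ : IsΔ₀ φ}} a ρ → ¬ ¬ (Σ ℕ λ b → ∀ x →
    (x ∈ b → x ∈ a × ⟦ φ ⟧ (x ◂ a ◂ ρ)) × (x ∈ a → ⟦ φ ⟧ (x ◂ a ◂ ρ) → x ∈ b))
  sep φ {{d}} a ρ k = separation φ d ρ a λ b h → k (b , λ x →
    (λ m → (λ n → imp-elim (proj₁ (h x)) m λ (y , _) → y n) ,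
      Sat-stable φ λ n → imp-elim (proj₁ (h x)) m λ (_ , s) → n (proj₁ (Sat-ren φ (env x b)) s)) ,
    λ m s → imp-elim (proj₂ (h x)) (m , proj₂ (Sat-ren φ (env x b)) s) >>= id)
    where
    env : ∀ x b i → (x ◂ b ◂ a ◂ ρ) (sepRen i) ≡ (x ◂ a ◂ ρ) i
    env x b 0 = refl
    env x b 1 = refl
    env x b (suc (suc i)) = refl

  col : ∀ φ {{_ : IsΔ₀ φ}} a ρ → (∀ x → x ∈ a → ¬ ¬ (Σ ℕ λ y → ⟦ φ ⟧ (y ◂ x ◂ a ◂ ρ))) →
    ¬ ¬ (Σ ℕ λ b → ∀ x → x ∈ a → ¬ ¬ (Σ ℕ λ y → y ∈ b × ⟦ φ ⟧ (y ◂ x ◂ a ◂ ρ)))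
  col φ {{d}} a ρ h k = collection φ d ρ a
    ((λ x m n → h x m λ (y , s) → n y s) , λ c → c λ b g → k (b , λ x m n →
      g x m λ y m' s → n (y , m' , proj₁ (Sat-ren φ (env x y b)) s)))
    where
    env : ∀ x y b i → (y ◂ x ◂ b ◂ a ◂ ρ) (colRen i) ≡ (y ◂ x ◂ a ◂ ρ) i
    env x y b 0 = refl
    env x y b 1 = refl
    env x y b 2 = refl
    env x y b (suc (suc (suc i))) = refl

  ∈-induction : ∀ φ ρ → (∀ x → (∀ y → y ∈ x → ⟦ φ ⟧ (y ◂ ρ)) → ⟦ φ ⟧ (x ◂ ρ)) →
    ∀ x → ⟦ φ ⟧ (x ◂ ρ)
  ∈-induction φ ρ step x = Sat-stable φ λ n → foundation (¬' φ) ρ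
    ((λ h → h x n) , λ c → c λ y (ny , min) → ny (step y λ z m → Sat-stable φ λ nz →
      min z m (proj₂ (Sat-ren (¬' φ) λ { zero → refl ; (suc i) → refl }) nz)))

  empty-exists : ¬ ¬ (Σ ℕ Empty)
  -- The number 0 serves as an arbitrary set of the model to separate from.
  empty-exists = sep (¬' (0 ≐ 0)) 0 id >>= λ (b , h) →
    return (b , λ a m → ⊥-elim (proj₂ (proj₁ (h a) m) ≈-refl))

  doub-exists : ∀ a b → ¬ ¬ (Σ ℕ λ q → Doub q a b)
  doub-exists a b k = pairing id a b λ c (a∈c , b∈c) →
    sep ((0 ≐ 2) ∨' (0 ≐ 3)) c (a ◂ b ◂ id) λ (q , h) →
      k (q , proj₂ (h a) a∈c (inl ≈-refl) , proj₂ (h b) b∈c (inr ≈-refl) ,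
         λ t m → proj₂ (proj₁ (h t) m))

  sing-exists : ∀ a → ¬ ¬ (Σ ℕ λ q → Sing q a)
  sing-exists a = doub-exists a a >>= λ (q , m , _ , h) →
    return (q , m , λ t m' → or-elim (h t m') id id)

  union-exists : ∀ a → ¬ ¬ (Σ ℕ λ u →
    (∀ x y → y ∈ a → x ∈ y → x ∈ u) × (∀ x → x ∈ u → Ex a λ y → x ∈ y))
  union-exists a k = union id a λ c h → sep (∃∈ 2 (1 ∈' 0)) c (a ◂ id) λ (u , g) →
    k (u , (λ x y m m' → proj₂ (g x) (h y m x m') (ex-intro y m m')) , λ x m → proj₂ (proj₁ (g x) m))

  adj-exists : ∀ u v → ¬ ¬ (Σ ℕ λ q → Adj q u v)
  adj-exists u v = sing-exists v >>= λ (s , v∈s , s⊆v) → doub-exists u s >>= λ (d , u∈d , s∈d , h) →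
    union-exists d >>= λ (q , g , g') → return (q , (λ t m → g t u u∈d m) , g v s s∈d v∈s ,
      λ t m → ex-elim (g' t m) >>= λ (y , y∈d , t∈y) →
        or-elim (h y y∈d) (λ e → inl (∈-respʳ e t∈y)) (λ e → inr (s⊆v t (∈-respʳ e t∈y))))

  pair-exists : ∀ a b → ¬ ¬ (Σ ℕ λ p → Pair p a b)
  pair-exists a b = sing-exists a >>= λ (s , S) → doub-exists a b >>= λ (d , D) →
    doub-exists s d >>= λ (p , s∈p , d∈p , h) → return (p , ex-intro s s∈p S , ex-intro d d∈p D ,
      λ q m → or-elim (h q m) (λ e → inl (Sing-resp (≈-sym e) ≈-refl S))
                              (λ e → inr (Doub-resp (≈-sym e) D)))

  union₂-exists : ∀ a b → ¬ ¬ (Σ ℕ λ u → (∀ x → x ∈ a → x ∈ u) × (∀ x → x ∈ b → x ∈ u))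
  union₂-exists a b = doub-exists a b >>= λ (d , a∈d , b∈d , _) →
    union-exists d >>= λ (u , g , _) → return (u , (λ x → g x a a∈d) , λ x → g x b b∈d)

  -- The cumulative hierarchy.

  Level : ℕ → ℕ → Set
  Level a' a = (∀ u → u ∈ a' → u ∈ a) ×
    (∀ u → u ∈ a' → ∀ v → v ∈ a' → Ex a λ t → Adj t u v)

  Below : ℕ → ℕ → ℕ → Set
  Below c z a = Ex c λ p → Ex p λ q → Ex q λ a' → Pair p z a' × Level a' a

  Coh : ℕ → Set
  Coh c = ∀ p → p ∈ c → ∀ q → q ∈ p → ∀ y → y ∈ q → ∀ a → a ∈ q →
    Imp (Pair p y a) (Ex a Empty × (∀ z → z ∈ y → Below c z a))

  Good : ℕ → ℕ → Set
  Good c x = Coh c × Ex c λ p → Ex p λ q → Ex q λ a → Pair p x a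

  Below-intro : ∀ {c z a p a'} → p ∈ c → Pair p z a' → Level a' a → Below c z a
  Below-intro {p = p} {a'} p∈c P L = ex-elim (proj₁ (proj₂ P)) >>= λ (q , q∈p , _ , a'∈q , _) →
    ex-intro p p∈c (ex-intro q q∈p (ex-intro a' a'∈q (P , L)))

  Below-elim : ∀ {c z a} → Below c z a →
    ¬ ¬ (Σ ℕ λ p → Σ ℕ λ a' → p ∈ c × Pair p z a' × Level a' a)
  Below-elim B = ex-elim B >>= λ (p , p∈c , B₁) → ex-elim B₁ >>= λ (q , q∈p , B₂) →
    ex-elim B₂ >>= λ (a' , a'∈q , P , L) → return (p , a' , p∈c , P , L)

  Coh-elim : ∀ {c p y a} → Coh c → p ∈ c → Pair p y a →
    ¬ ¬ (Ex a Empty × (∀ z → z ∈ y → Below c z a))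
  Coh-elim {p = p} h p∈c P = ex-elim (proj₁ (proj₂ P)) >>= λ (q , q∈p , y∈q , a∈q , _) →
    imp-elim (h p p∈c q q∈p _ y∈q _ a∈q) P

  Good-elim : ∀ {c x} → Good c x → ¬ ¬ (Σ ℕ λ p → Σ ℕ λ a → p ∈ c × Pair p x a)
  Good-elim (_ , B) = ex-elim B >>= λ (p , p∈c , B₁) → ex-elim B₁ >>= λ (q , q∈p , B₂) →
    ex-elim B₂ >>= λ (a' , a'∈q , P) → return (p , a' , p∈c , P)

  -- Nested collection: for fixed `u` over all `v`, then over all `u`. The union holds all the
  -- adjunctions; `b` and the empty set are added.
  level-exists : ∀ b → ¬ ¬ (Σ ℕ λ a → Level b a × Ex a Empty)
  level-exists b =
    col (∀∈ 2 (∃∈ 1 (adjF 0 3 1))) b id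
      (λ u _ → col (adjF 0 3 1) b (u ◂ id) (λ v _ → adj-exists u v) >>= λ (q , h) →
        return (q , λ v m → λ n → h v m λ (t , t∈q , A) → n t t∈q A)) >>= λ (Q , h) →
    union-exists Q >>= λ (W , g , _) → union₂-exists b W >>= λ (W' , b⊆ , W⊆) →
    empty-exists >>= λ (e , em) → adj-exists W' e >>= λ (a , W'⊆ , e∈a , _) →
    return (a , ((λ u m → W'⊆ u (b⊆ u m)) , λ u m v m' →
      h u m >>= λ (q , q∈Q , k) → ex-elim (k v m') >>= λ (t , t∈q , A) →
      ex-intro t (W'⊆ t (W⊆ t (g t q q∈Q t∈q))) A) , ex-intro e e∈a em)

  -- Coherence asks only for the existence of lower pairs, so it survives unions. One level `a`
  -- above all levels in the union of the coherent sets serves for `x`.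
  good-step : ∀ x → (∀ z → z ∈ x → ¬ ¬ (Σ ℕ λ c → Good c z)) → ¬ ¬ (Σ ℕ λ c → Good c x)
  good-step x IH =
    col (goodF 0 1) x id IH >>= λ (B , hB) →
    -- Collection may have added incoherent sets.
    sep (cohF 0) B id >>= λ (B' , hB') →
    union-exists B' >>= λ (C , C⊇ , C⊆) →
    -- Elements `u` of levels satisfy `u` ∈ `a'` ∈ `q'` ∈ `p'` ∈ `C`, hence three unions.
    union-exists C >>= λ (U₁ , U₁⊇ , _) →
    union-exists U₁ >>= λ (U₂ , U₂⊇ , _) →
    union-exists U₂ >>= λ (b , b⊇ , _) →
    level-exists b >>= λ (a , (b⊆a , adj) , e) →
    pair-exists x a >>= λ (p , P) →
    adj-exists C p >>= λ (c , C⊆c , p∈c , c⊆) →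
    let
      old : ∀ {p₁ y a₁} → p₁ ∈ C → Pair p₁ y a₁ →
        ¬ ¬ (Ex a₁ Empty × (∀ z → z ∈ y → Below c z a₁))
      old p₁∈C P₁ = ex-elim (C⊆ _ p₁∈C) >>= λ (c₀ , c₀∈B' , p₁∈c₀) →
        Coh-elim (proj₂ (proj₁ (hB' c₀) c₀∈B')) p₁∈c₀ P₁ >>= λ (e₁ , f) →
        return (e₁ , λ z z∈y → Below-elim (f z z∈y) >>= λ (p' , a' , p'∈c₀ , P' , L) →
          Below-intro (C⊆c p' (C⊇ p' c₀ c₀∈B' p'∈c₀)) P' L)

      new : ∀ z → z ∈ x → ¬ ¬ (Σ ℕ λ p' → Σ ℕ λ a' → p' ∈ c × Pair p' z a' × Level a' a)
      new z z∈x = hB z z∈x >>= λ (c₀ , c₀∈B , G) →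
        Good-elim G >>= λ (p' , a' , p'∈c₀ , P') →
        ex-elim (proj₁ (proj₂ P')) >>= λ (q' , q'∈p' , _ , a'∈q' , _) →
        let p'∈C = C⊇ p' c₀ (proj₂ (hB' c₀) c₀∈B (proj₁ G)) p'∈c₀
            a'⊆b = λ u m → b⊇ u a' (U₂⊇ a' q' (U₁⊇ q' p' p'∈C q'∈p') a'∈q') m
        in return (p' , a' , C⊆c p' p'∈C , P' ,
             (λ u m → b⊆a u (a'⊆b u m)) , λ u m v m' → adj u (a'⊆b u m) v (a'⊆b v m'))

      coh : Coh c
      coh p₁ p₁∈c q _ y _ a₁ _ = imp-intro λ P₁ → or-elim (c⊆ p₁ p₁∈c)
        (λ p₁∈C → old p₁∈C P₁)
        (λ p₁≈p → let P₂ = Pair-resp p₁≈p ≈-refl ≈-refl P₁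
                      y≈x = Pair-injˡ P₂ P
                      a≈a₁ = ≈-sym (Pair-injʳ P₂ P)
                  in return ((ex-elim e >>= λ (t , t∈a , em) → ex-intro t (∈-respʳ a≈a₁ t∈a) em) ,
                       λ z z∈y → new z (∈-respʳ y≈x z∈y) >>= λ (p' , a' , p'∈c , P' , a'⊆a , A) →
                         Below-intro p'∈c P' ((λ u m → ∈-respʳ a≈a₁ (a'⊆a u m)) ,
                           λ u m v m' → ex-elim (A u m v m') >>= λ (t , t∈a , D) →
                             ex-intro t (∈-respʳ a≈a₁ t∈a) D)))
    in ex-elim (proj₁ (proj₂ P)) >>= λ (q , q∈p , _ , a∈q , _) →
       return (c , coh , ex-intro p p∈c (ex-intro q q∈p (ex-intro a a∈q P)))

  good-exists : ∀ x → ¬ ¬ (Σ ℕ λ c → Good c x)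
  good-exists x = toΣ (∈-induction (∃' (goodF 0 1)) id
    (λ x h → fromΣ (good-step x λ z m → toΣ (h z m))) x)
    where
    toΣ : ∀ {P : ℕ → Set} → ¬ (∀ a → ¬ P a) → ¬ ¬ (Σ ℕ P)
    toΣ f k = f λ a p → k (a , p)
    fromΣ : ∀ {P : ℕ → Set} → ¬ ¬ (Σ ℕ P) → ¬ (∀ a → ¬ P a)
    fromΣ nn f = nn λ (a , p) → f a p

  -- Hereditarily finite sets and the universe.

  Lvl : ℕ → ℕ → Set
  Lvl zero    y = ⊤
  Lvl (suc n) y = ¬ ¬ (Σ ℕ λ z → z ∈ y × Lvl n z)

  -- Lvl n y says that y has rank at least n.
  In : ℕ → ℕ → Set
  In n x = ∀ c p y a → Coh c → p ∈ c → Pair p y a → Lvl n y → x ∈ a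

  HF : ℕ → Set
  HF x = ¬ ¬ (Σ ℕ λ n → In n x)

  HF-empty : ∀ {x} → Empty x → HF x
  HF-empty {x} em = return (0 , λ c p y a C m P _ → Coh-elim C m P >>= λ (e , _) →
    ex-elim e >>= λ (t , t∈a , em') →
    ∈-respˡ (ext-≈ (λ _ m → ⊥-elim (∉-empty em' m)) (λ _ m → ⊥-elim (∉-empty em m))) t∈a)

  In-suc : ∀ {n x} → In n x → In (suc n) x
  In-suc h c p y a C m P l = l >>= λ (z , z∈y , lz) → Coh-elim C m P >>= λ (_ , f) →
    Below-elim (f z z∈y) >>= λ (p' , a' , p'∈c , P' , a'⊆a , _) →
    a'⊆a _ (h c p' z a' C p'∈c P' lz)

  In-≤ : ∀ {n k x} → n ≤ k → In n x → In k x
  In-≤ {k = zero}  z≤n h = h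
  In-≤ {k = suc k} le h with m≤n⇒m<n∨m≡n le
  ... | inj₁ (s≤s le') = In-suc {k} (In-≤ le' h)
  ... | inj₂ refl = h

  Adj-unique : ∀ {q q' u v} → Adj q u v → Adj q' u v → q ≈ q'
  Adj-unique A A' = ext-≈ (incl A A') (incl A' A)
    where
    incl : ∀ {q q' u v} → Adj q u v → Adj q' u v → ∀ t → t ∈ q → t ∈ q'
    incl (_ , _ , h) (f , v∈ , _) t m = or-elim (h t m) (f t) (λ e → ∈-respˡ (≈-sym e) v∈)

  -- An index of rank above `n` and `k` has an element whose level contains both `u` and `v`; the
  -- next level is closed under adjunction of these.
  HF-adj : ∀ {q u v} → HF u → HF v → Adj q u v → HF q
  HF-adj {q} {u} {v} hu hv A = hu >>= λ (n , iu) → hv >>= λ (k , iv) →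
    return (suc (n ⊔ k) , λ c p y a C m P l → l >>= λ (z , z∈y , lz) →
      Coh-elim C m P >>= λ (_ , f) →
      Below-elim (f z z∈y) >>= λ (p' , a' , p'∈c , P' , _ , adj) →
      ex-elim (adj u (In-≤ (m≤m⊔n n k) iu c p' z a' C p'∈c P' lz)
                   v (In-≤ (m≤n⊔m n k) iv c p' z a' C p'∈c P' lz)) >>= λ (t , t∈a , A') →
      ∈-respˡ (Adj-unique A' A) t∈a)

  HF-sing : ∀ {q a} → HF a → Sing q a → HF q
  HF-sing {q} {a} h (a∈q , g) = empty-exists >>= λ (e , em) →
    HF-adj (HF-empty em) h ((λ t m → ⊥-elim (∉-empty em m)) , a∈q , λ t m → inr (g t m))

  HF-doub : ∀ {q a b} → HF a → HF b → Doub q a b → HF q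
  HF-doub {q} {a} {b} ha hb (a∈q , b∈q , g) = sing-exists a >>= λ (s , a∈s , h) →
    HF-adj (HF-sing ha (a∈s , h)) hb ((λ t m → ∈-respˡ (≈-sym (h t m)) a∈q) , b∈q ,
      λ t m → or-elim (g t m) (λ e → inl (∈-respˡ (≈-sym e) a∈s)) inr)

  Sing-unique : ∀ {q q' a} → Sing q a → Sing q' a → q ≈ q'
  Sing-unique (m , h) (m' , h') =
    ext-≈ (λ x k → ∈-respˡ (≈-sym (h x k)) m') (λ x k → ∈-respˡ (≈-sym (h' x k)) m)

  HF-pair : ∀ {p a b} → HF a → HF b → Pair p a b → HF p
  HF-pair ha hb (es , ed , h) = ex-elim es >>= λ (s , s∈p , S) → ex-elim ed >>= λ (d , d∈p , D) →
    HF-doub (HF-sing ha S) (HF-doub ha hb D) (s∈p , d∈p ,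
      λ t m → or-elim (h t m) (λ S' → inl (Sing-unique S' S)) (λ D' → inr (Doub-unique D' D)))
    where
    Doub-unique : ∀ {q q' a b} → Doub q a b → Doub q' a b → q ≈ q'
    Doub-unique D D' = ext-≈ (incl D D') (incl D' D)
      where
      incl : ∀ {q q' a b} → Doub q a b → Doub q' a b → ∀ t → t ∈ q → t ∈ q'
      incl (_ , _ , h) (a∈ , b∈ , _) t m =
        or-elim (h t m) (λ e → ∈-respˡ (≈-sym e) a∈) (λ e → ∈-respˡ (≈-sym e) b∈)

  Lvl-exists : ¬ ¬ (Σ ℕ λ I → ∀ n → ¬ ¬ (Σ ℕ λ i → i ∈ I × Lvl n i))
  Lvl-exists k = infinity id λ I (ne , up) → k (I , go I ne up)
    where
    go : ∀ I → _ → _ → ∀ n → ¬ ¬ (Σ ℕ λ i → i ∈ I × Lvl n i)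
    go I ne up zero    = ex-elim ne >>= λ (i , m , _) → return (i , m , tt)
    go I ne up (suc n) = go I ne up n >>= λ (i , m , l) → ex-elim (up i m) >>= λ (j , j∈I , i∈j , _) →
      return (j , j∈I , return (i , i∈j , l))

  -- The set from Infinity has indices of every standard rank. Collecting a coherent set for each
  -- index and descending to the elements of levels catches every `HF` set.
  universe-exists : ¬ ¬ (Σ ℕ λ V → ∀ x → HF x → x ∈ V)
  universe-exists = Lvl-exists >>= λ (I , hI) →
    col (goodF 0 1) I id (λ i _ → good-exists i) >>= λ (B , hB) →
    union-exists B >>= λ (U₁ , U₁⊇ , _) → union-exists U₁ >>= λ (U₂ , U₂⊇ , _) →
    union-exists U₂ >>= λ (U₃ , U₃⊇ , _) → union-exists U₃ >>= λ (V , V⊇ , _) →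
    return (V , λ x hx → hx >>= λ (n , ix) → hI n >>= λ (i , i∈I , l) →
      hB i i∈I >>= λ (c , c∈B , G) → Good-elim G >>= λ (p , a , p∈c , P) →
      ex-elim (proj₁ (proj₂ P)) >>= λ (q , q∈p , _ , a∈q , _) →
      V⊇ x a (U₃⊇ a q (U₂⊇ q p (U₁⊇ p c c∈B p∈c) q∈p) a∈q) (ix c p i a (proj₁ G) p∈c P l))

  -- Zermelo numerals.

  Num : ℕ → ℕ → Set
  Num zero    x = Empty x
  Num (suc n) x = ¬ ¬ (Σ ℕ λ y → Num n y × Sing x y)

  Num-stable : ∀ n {x} → ¬ ¬ Num n x → Num n x
  Num-stable zero    nn a m m' = nn λ h → h a m m'
  Num-stable (suc n) nn = nn >>= id

  Sing-injective : ∀ {x y y'} → Sing x y → Sing x y' → y ≈ y'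
  Sing-injective (m , _) (_ , h) = h _ m

  Num-resp : ∀ n {x x'} → x ≈ x' → Num n x → Num n x'
  Num-resp zero    e h a m _ = ∉-empty h (∈-respʳ (≈-sym e) m)
  Num-resp (suc n) e h = h >>= λ (y , N , S) → return (y , N , Sing-resp e ≈-refl S)

  Num-unique : ∀ n {x y} → Num n x → Num n y → x ≈ y
  Num-unique zero    h g = ext-≈ (λ _ m → ⊥-elim (∉-empty h m)) (λ _ m → ⊥-elim (∉-empty g m))
  Num-unique (suc n) h g = h >>= λ (x' , N , S) → g >>= λ (y' , N' , S') →
    Sing-unique S (Sing-resp ≈-refl (Num-unique n N' N) S')

  Num-exists : ∀ n → ¬ ¬ (Σ ℕ (Num n))
  Num-exists zero    = empty-exists
  Num-exists (suc n) = Num-exists n >>= λ (y , N) → sing-exists y >>= λ (x , S) →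
    return (x , return (y , N , S))

  Num-HF : ∀ n {x} → Num n x → HF x
  Num-HF zero    h = HF-empty h
  Num-HF (suc n) h = h >>= λ (y , N , S) → HF-sing (Num-HF n N) S

  Num-pred : ∀ n {x y} → Num (suc n) x → Sing x y → Num n y
  Num-pred n h S = Num-stable n (h >>= λ (y' , N , S') →
    return (Num-resp n (Sing-injective S' S) N))

  -- Representation of terms in the model.

  Table : (ℕ → ℕ) → ℕ → ℕ → Set
  Table f N s =
    (∀ M → M ≤ N → ¬ ¬ (Σ ℕ λ p → Σ ℕ λ i → Σ ℕ λ u →
      p ∈ s × Pair p i u × Num M i × Num (f M) u)) ×
    (∀ p i u → p ∈ s → Pair p i u → ¬ ¬ (Σ ℕ λ M → M ≤ N × Num M i × Num (f M) u))

  table-exists : ∀ f N → ¬ ¬ (Σ ℕ λ s → HF s × Table f N s)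
  table-exists f N = Num-exists N >>= λ (i , Ni) → Num-exists (f N) >>= λ (u , Nu) →
    pair-exists i u >>= λ (p , P) → extend N i u p Ni Nu P
    where
    own : ∀ {N i u p} → Num N i → Num (f N) u → Pair p i u →
      ∀ p' i' u' → p' ≈ p → Pair p' i' u' → ¬ ¬ (Σ ℕ λ M → M ≤ N × Num M i' × Num (f M) u')
    own {N} Ni Nu P p' i' u' e P' =
      let P″ = Pair-resp e ≈-refl ≈-refl P' in
      return (N , ≤-refl , Num-resp N (Pair-injˡ P P″) Ni , Num-resp (f N) (Pair-injʳ P P″) Nu)

    extend : ∀ N i u p → Num N i → Num (f N) u → Pair p i u → ¬ ¬ (Σ ℕ λ s → HF s × Table f N s)
    extend zero i u p Ni Nu P = sing-exists p >>= λ (s , p∈s , h) →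
      return (s , HF-sing (HF-pair (Num-HF 0 Ni) (Num-HF (f 0) Nu) P) (p∈s , h) ,
        (λ { .0 z≤n → return (p , i , u , p∈s , P , Ni , Nu) }) ,
        λ p' i' u' m P' → own Ni Nu P p' i' u' (h p' m) P')
    extend (suc N) i u p Ni Nu P = table-exists f N >>= λ (s , hs , low , high) →
      adj-exists s p >>= λ (s' , s⊆ , p∈s' , h) →
      return (s' , HF-adj hs (HF-pair (Num-HF (suc N) Ni) (Num-HF (f (suc N)) Nu) P) (s⊆ , p∈s' , h) ,
        (λ M le → cover M s s' p∈s' s⊆ low (m≤n⇒m<n∨m≡n le)) ,
        λ p' i' u' m P' → or-elim (h p' m)
          (λ m' → high p' i' u' m' P' >>= λ (M , le , NN) → return (M , m≤n⇒m≤1+n le , NN))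
          (λ e → own Ni Nu P p' i' u' e P'))
      where
      cover : ∀ M s s' → p ∈ s' → (∀ t → t ∈ s → t ∈ s') →
        (∀ M → M ≤ N → ¬ ¬ (Σ ℕ λ p → Σ ℕ λ i → Σ ℕ λ u →
          p ∈ s × Pair p i u × Num M i × Num (f M) u)) →
        M < suc N ⊎ M ≡ suc N →
        ¬ ¬ (Σ ℕ λ p → Σ ℕ λ i → Σ ℕ λ u → p ∈ s' × Pair p i u × Num M i × Num (f M) u)
      cover M s s' p∈s' s⊆ low (inj₁ (s≤s le)) = low M le >>= λ (p' , i' , u' , m , rest) →
        return (p' , i' , u' , s⊆ p' m , rest)
      cover M s s' p∈s' s⊆ low (inj₂ refl) = return (p , i , u , p∈s' , P , Ni , Nu)

  Represents : (ℕ → ℕ) → (ℕ → ℕ) → (ℕ → ℕ) → Set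
  Represents ρ r γ = ∀ i → Num (γ i) (ρ (r i))

  Universe : ℕ → Set
  Universe V = ∀ x → HF x → x ∈ V

  rep-correct : ∀ t {w v r ρ γ} → Universe (ρ v) → Represents ρ r γ →
    (⟦ repF t w v r ⟧ ρ → Num (eval t γ) (ρ w)) × (Num (eval t γ) (ρ w) → ⟦ repF t w v r ⟧ ρ)
  rep-correct (var i) {γ = γ} U G =
    (λ e → Num-resp (γ i) (≈-sym e) (G i)) , λ N → Num-unique (γ i) N (G i)
  rep-correct ze U G = id , id
  rep-correct (su t) {γ = γ} U G =
    (λ s → ex-elim s >>= λ (y , _ , s' , S) → return (y , proj₁ (rep-correct t U G) s' , S)) ,
    (λ N → N >>= λ (y , N' , S) →
      ex-intro y (U y (Num-HF (eval t γ) N')) (proj₂ (rep-correct t U G) N' , S))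
  rep-correct (at t i j k) U G = rep-correct t U λ where
    0 → G i
    1 → G j
    2 → G k
    (suc (suc (suc _))) → G k
  rep-correct (rec t b s) {w} {v} {r} {ρ} {γ} U G = to , from
    where
    f : ℕ → ℕ
    f = natrec (eval b γ) (λ i a → eval s (a ◂ i ◂ γ))

    G₂ : ∀ {p' u' j u i p g n a m} → Num a u' → Num m j →
      Represents (p' ◂ u' ◂ j ◂ u ◂ i ◂ p ◂ g ◂ n ◂ ρ)
        (1 ◂ 2 ◂ (6 +_) ∘ (2 +_) ∘ r) (a ◂ m ◂ γ)
    G₂ Na Nm 0 = Na
    G₂ Na Nm 1 = Nm
    G₂ Na Nm (suc (suc k)) = G k

    -- Descends from pair to pair in the table; induction on the standard number `M` suffices even
    -- if the table has nonstandard arguments.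
    walk : ∀ n g → ⟦ tableF b s 0 (2 + v) ((2 +_) ∘ r) ⟧ (g ◂ n ◂ ρ) →
      ∀ M p i u → p ∈ g → i ∈ ρ v → u ∈ ρ v → Pair p i u → Num M i → Num (f M) u
    walk n g tab zero p i u p∈g iV uV P Ni =
      Num-stable (f 0) (imp-elim (tab p p∈g i iV u uV) P >>= λ o → or-elim o
        (λ (_ , sb) → return (proj₁ (rep-correct b U G) sb))
        (λ e → ⊥-elim (ex-elim e λ (j , _ , e₁) → ex-elim e₁ λ (u' , _ , e₂) →
          ex-elim e₂ λ (p' , _ , _ , (j∈i , _) , _) → ∉-empty Ni j∈i)))
    walk n g tab (suc M) p i u p∈g iV uV P Ni =
      Num-stable (f (suc M)) (imp-elim (tab p p∈g i iV u uV) P >>= λ o → or-elim o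
        (λ (em , _) → ⊥-elim (Ni λ (y , _ , y∈i , _) → ∉-empty em y∈i))
        (λ e → ex-elim e >>= λ (j , jV , e₁) → ex-elim e₁ >>= λ (u' , u'V , e₂) →
          ex-elim e₂ >>= λ (p' , p'∈g , P' , S , ss) →
          let Nj = Num-pred M Ni S
              Nu' = walk n g tab M p' j u' p'∈g jV u'V P' Nj
          in return (proj₁ (rep-correct s U (G₂ Nu' Nj)) ss)))

    to : ⟦ repF (rec t b s) w v r ⟧ ρ → Num (f (eval t γ)) (ρ w)
    to (wV , e) = Num-stable (f (eval t γ)) (ex-elim e >>= λ (n , nV , st , e₁) →
      ex-elim e₁ >>= λ (g , _ , e₂ , tab) → ex-elim e₂ >>= λ (p , p∈g , P) →
      return (walk n g tab (eval t γ) p n (ρ w) p∈g nV wV P (proj₁ (rep-correct t U G) st)))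

    build : ∀ n g N → Table f N g → ⟦ tableF b s 0 (2 + v) ((2 +_) ∘ r) ⟧ (g ◂ n ◂ ρ)
    build n g N (low , high) p p∈g i iV u uV = imp-intro λ P → high p i u p∈g P >>= λ where
      (zero , _ , Ni , Nu) → return (inl (Ni , proj₂ (rep-correct b U G) Nu))
      (suc M , le , Ni , Nu) → Ni >>= λ (j , Nj , S) →
        low M (<⇒≤ le) >>= λ (p' , j' , u' , p'∈g , P' , Nj' , Nu') →
        return (inr (ex-intro j (U j (Num-HF M Nj)) (ex-intro u' (U u' (Num-HF (f M) Nu'))
          (ex-intro p' p'∈g (Pair-resp ≈-refl (Num-unique M Nj' Nj) ≈-refl P' , S ,
            proj₂ (rep-correct s U (G₂ Nu' Nj)) Nu)))))

    from : Num (f (eval t γ)) (ρ w) → ⟦ repF (rec t b s) w v r ⟧ ρ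
    from Nw = U (ρ w) (Num-HF (f (eval t γ)) Nw) ,
      (Num-exists (eval t γ) >>= λ (n , Nn) → table-exists f (eval t γ) >>= λ (g , hg , T) →
       proj₁ T (eval t γ) ≤-refl >>= λ (p , n' , w' , p∈g , P , Nn' , Nw') →
       ex-intro n (U n (Num-HF (eval t γ) Nn)) (proj₂ (rep-correct t U G) Nn ,
         ex-intro g (U g hg) (ex-intro p p∈g
           (Pair-resp ≈-refl (Num-unique (eval t γ) Nn' Nn) (Num-unique (f (eval t γ)) Nw' Nw) P) ,
           build n g (eval t γ) T)))

  -- The search formula.

  segment-exists : ∀ K → ¬ ¬ (Σ ℕ λ σ → HF σ ×
    (∀ k → k ≤ K → ¬ ¬ (Σ ℕ λ y → y ∈ σ × Num k y)) ×
    (∀ y → y ∈ σ → ¬ ¬ (Σ ℕ λ k → k ≤ K × Num k y)))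
  segment-exists zero = empty-exists >>= λ (e , em) → sing-exists e >>= λ (σ , e∈σ , h) →
    return (σ , HF-sing (HF-empty em) (e∈σ , h) , (λ { .0 z≤n → return (e , e∈σ , em) }) ,
      λ y m → return (0 , z≤n , Num-resp 0 (≈-sym (h y m)) em))
  segment-exists (suc K) = segment-exists K >>= λ (σ , hσ , low , high) →
    Num-exists (suc K) >>= λ (x , Nx) → adj-exists σ x >>= λ (σ' , σ⊆ , x∈σ' , h) →
    return (σ' , HF-adj hσ (Num-HF (suc K) Nx) (σ⊆ , x∈σ' , h) ,
      (λ k le → cover σ σ' x low σ⊆ x∈σ' Nx k (m≤n⇒m<n∨m≡n le)) ,
      λ y m → or-elim (h y m)
        (λ m' → high y m' >>= λ (k , le , N) → return (k , m≤n⇒m≤1+n le , N))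
        (λ e → return (suc K , ≤-refl , Num-resp (suc K) (≈-sym e) Nx)))
    where
    cover : ∀ σ σ' x → (∀ k → k ≤ K → ¬ ¬ (Σ ℕ λ y → y ∈ σ × Num k y)) →
      (∀ t → t ∈ σ → t ∈ σ') → x ∈ σ' → Num (suc K) x →
      ∀ k → k < suc K ⊎ k ≡ suc K → ¬ ¬ (Σ ℕ λ y → y ∈ σ' × Num k y)
    cover σ σ' x low σ⊆ x∈σ' Nx k (inj₁ (s≤s le)) = low k le >>= λ (y , m , N) →
      return (y , σ⊆ y m , N)
    cover σ σ' x low σ⊆ x∈σ' Nx k (inj₂ refl) = return (x , x∈σ' , Nx)

  module Search (t : Tm) {V : ℕ} {ρ γ : ℕ → ℕ} (U : Universe V)
                (G : ∀ i → Num (γ i) (ρ i)) (n : ℕ) {x : ℕ} (Nx : Num n x) where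

    value : ℕ → ℕ
    value k = eval t (n ◂ k ◂ γ)

    G' : ∀ {v j σ k} → Num k j →
      Represents (v ◂ j ◂ σ ◂ x ◂ V ◂ ρ) (3 ◂ 1 ◂ (5 +_)) (n ◂ k ◂ γ)
    G' Nj 0 = Nx
    G' Nj 1 = Nj
    G' Nj (suc (suc i)) = G i

    Run : ℕ → Set
    Run σ = ∀ j → j ∈ σ → Ex V λ v →
      ⟦ repF t 0 4 (3 ◂ 1 ◂ (5 +_)) ⟧ (v ◂ j ◂ σ ◂ x ◂ V ◂ ρ) ×
      Or (Ex v Empty) (Empty v × Ex σ λ j' → Sing j' j)

    -- The witness is the segment 0, ..., `k₀`, which may be left at `k₀` because the value there is
    -- 1.
    search-yes : ∀ k₀ → value k₀ ≡ 1 → (∀ k → k < k₀ → value k ≡ 0) →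
      ⟦ searchF t ⟧ (x ◂ V ◂ ρ)
    search-yes k₀ hit miss = segment-exists k₀ >>= λ (σ , hσ , low , high) →
      low 0 z≤n >>= λ (o , o∈σ , em) →
      ex-intro σ (U σ hσ) (ex-intro o o∈σ em , λ j j∈σ →
        high j j∈σ >>= λ (k , le , Nj) → Num-exists (value k) >>= λ (v , Nv) →
        ex-intro v (U v (Num-HF (value k) Nv))
          (proj₂ (rep-correct t U (G' Nj)) Nv , branch σ low j k Nj v Nv (m≤n⇒m<n∨m≡n le)))
      where
      branch : ∀ σ → (∀ k → k ≤ k₀ → ¬ ¬ (Σ ℕ λ y → y ∈ σ × Num k y)) →
        ∀ j k → Num k j → ∀ v → Num (value k) v → k < k₀ ⊎ k ≡ k₀ →
        Or (Ex v Empty) (Empty v × Ex σ λ j' → Sing j' j)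
      branch σ low j k Nj v Nv (inj₁ lt) = inr (subst (λ a → Num a v) (miss k lt) Nv ,
        (low (suc k) lt >>= λ (j' , j'∈σ , Nj') → Nj' >>= λ (y , Ny , S) →
         ex-intro j' j'∈σ (Sing-resp ≈-refl (Num-unique k Ny Nj) S)))
      branch σ low j k Nj v Nv (inj₂ refl) = subst (λ a → Num a v) hit Nv >>= λ (y , em , y∈v , _) →
        inl (ex-intro y y∈v em)

    -- A witness contains 0 and, by induction on standard numbers, every numeral up to `k₀`. There
    -- the value 2 = {{∅}} is nonempty but has no empty element, so both alternatives fail.
    search-no : ∀ k₀ → value k₀ ≡ 2 → (∀ k → k < k₀ → value k ≡ 0) →
      ¬ ⟦ searchF t ⟧ (x ◂ V ◂ ρ)
    search-no k₀ hit miss s = ex-elim s λ (σ , _ , e₀ , run) →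
      climb σ e₀ run k₀ ≤-refl λ (j , j∈σ , Nj) → ex-elim (run j j∈σ) λ (v , _ , sv , o) →
      subst (λ a → Num a v) hit (proj₁ (rep-correct t U (G' Nj)) sv) λ (y , Ny , y∈v , h) →
      Ny λ (y' , _ , y'∈y , _) →
      o ((λ e → ex-elim e λ (u , u∈v , em) → ∉-empty em (∈-respʳ (≈-sym (h u u∈v)) y'∈y)) ,
         λ (em , _) → ∉-empty em y∈v)
      where
      climb : ∀ σ → Ex σ Empty → Run σ → ∀ k → k ≤ k₀ → ¬ ¬ (Σ ℕ λ j → j ∈ σ × Num k j)
      climb σ e₀ run zero    _  = ex-elim e₀
      climb σ e₀ run (suc k) lt = climb σ e₀ run k (<⇒≤ lt) >>= λ (j , j∈σ , Nj) →
        ex-elim (run j j∈σ) >>= λ (v , _ , sv , o) →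
        let Nv = subst (λ a → Num a v) (miss k lt) (proj₁ (rep-correct t U (G' Nj)) sv)
        in or-elim o (λ e → ⊥-elim (ex-elim e λ (y , y∈v , _) → ∉-empty Nv y∈v))
             (λ (_ , e) → ex-elim e >>= λ (j' , j'∈σ , S) →
               return (j' , j'∈σ , return (j , Nj , S)))

  -- The diagonal argument.

  pair-not-numeral : ∀ {o l m} → Num 0 o → Num 1 l → Doub m o l → ∀ n → ¬ Num n m
  pair-not-numeral No Nl (o∈m , _) zero N = ∉-empty N o∈m
  -- All elements of a successor numeral are equal, which would give 0 = 1.
  pair-not-numeral No Nl (o∈m , l∈m , _) (suc n) N = N λ (y , _ , _ , h) → Nl λ (t , _ , t∈l , _) →
    ∉-empty No (∈-respʳ (≈-trans (h _ l∈m) (≈-sym (h _ o∈m))) t∈l)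

  module Diagonal (e : PR 2) (e-halts : ∀ x y → ε x y ⇔ Halts e (x ∷ y ∷ []))
    {V : ℕ} (U : Universe V)
    {z : ℕ} (Nz : Num 0 z)
    {Z : ℕ} (Z-spec : ∀ x → (x ∈ Z → x ∈ V × (∀ y → y ∈ x → ∀ y' → y' ∈ x → y ≈ y')) ×
                            (x ∈ V → (∀ y → y ∈ x → ∀ y' → y' ∈ x → y ≈ y') → x ∈ Z))
    {m : ℕ} (m-not-numeral : ∀ n → ¬ Num n m) where

    open Certificates e
    open Values z Z m

    halt-∈ : ∀ {c x y v} → halt c x y ≡ suc v → x ∈ y
    halt-∈ h = return (proj₂ (e-halts _ _) (halt-sound h))

    ∈-halt : ∀ {x y} → x ∈ y → ¬ ¬ (Σ ℕ λ K → Σ ℕ λ v → ∀ c → K ≤ c → halt c x y ≡ suc v)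
    ∈-halt m = m >>= λ h → return (halt-complete (proj₁ (e-halts _ _) h))

    -- `r'` in `Z` has at most one element, so `r` ε `r'` forces `r'` = {`r`}.
    numeral-sound : ∀ k n {r} → numeral k n ≡ suc r → Num n r
    numeral-sound k zero refl = Nz
    numeral-sound k (suc n) e≡ with numeral k n | numeral-sound k n
    ... | suc r | ih with bfind-sound (λ c → bfind (next r c) c) k e≡
    ... | c , _ , eq₁ with bfind-sound (next r c) c eq₁
    ... | r' , _ , eq₂ with guard-suc (halt c r r') eq₂
    ... | (_ , h₁) , eq₃ with guard-suc (halt c r' Z) eq₃
    ... | (_ , h₂) , refl = return (r , ih refl , halt-∈ h₁ , λ t t∈r' →
      proj₂ (proj₁ (Z-spec r') (halt-∈ h₂)) t t∈r' r (halt-∈ h₁))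

    numeral-complete : ∀ n → ¬ ¬ (Σ ℕ λ K → Σ ℕ λ r → ∀ k → K ≤ k → numeral k n ≡ suc r)
    numeral-complete zero = return (0 , z , λ _ _ → refl)
    numeral-complete (suc n) = numeral-complete n >>= λ (K , r , h) →
      let Nr = numeral-sound K n (h K ≤-refl) in
      sing-exists r >>= λ (r' , S@(r∈r' , r'⊆)) →
      ∈-halt r∈r' >>= λ (K₁ , v₁ , h₁) →
      ∈-halt (proj₂ (Z-spec r') (U r' (Num-HF (suc n) (return (r , Nr , S))))
                (λ y y∈ y' y'∈ → ≈-trans (r'⊆ y y∈) (≈-sym (r'⊆ y' y'∈)))) >>= λ (K₂ , v₂ , h₂) →
      -- The inner search tries only numbers below `c`, so `c` must exceed `r'`. It may stop at
      -- another number than `r'`; by `numeral-sound` that is again a representative.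
      let c = suc r' ⊔ (K₁ ⊔ K₂)
          le = m≤n⊔m (suc r') (K₁ ⊔ K₂)
          found = trans (guard-true (h₁ c (≤-trans (m≤m⊔n K₁ K₂) le)))
                        (guard-true (h₂ c (≤-trans (m≤n⊔m K₁ K₂) le)))
          inner = bfind-complete (next r c) (m≤m⊔n (suc r') (K₁ ⊔ K₂)) found
          outer = bfind-complete (λ c → bfind (next r c) c) (≤-refl {suc c}) (proj₂ inner)
      in return (K ⊔ suc c , proj₁ outer , λ k le' →
           natrec-suc (h k (≤-trans (m≤m⊔n K (suc c)) le')) λ _ →
             bfind-stable (λ c → bfind (next r c) c) (≤-trans (m≤n⊔m K (suc c)) le') (proj₂ outer))

    -- Indexed by the value of `cert`. In `outside`, `q` will turn out to be the complement `T` with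
    -- `m` adjoined.
    data Verdict (n : ℕ) : ℕ → Set where
      none    : Verdict n 0
      outside : ∀ r q → Num n r → q ∈ n → m ∈ q → r ∈ q → Verdict n 1
      inside  : ∀ r → Num n r → r ∈ n → Verdict n 2

    verdict : ∀ n k → Verdict n (cert n k)
    verdict n k with numeral k n | numeral-sound k n
    ... | zero  | _ = none
    ... | suc r | Nr with halt k r n | halt-∈ {k} {r} {n}
    ...   | suc _ | r∈n = inside r (Nr refl) (r∈n refl)
    ...   | zero  | _ with bfind (cert₁ n k r) k | bfind-sound (cert₁ n k r) k
    ...     | zero  | _ = none
    ...     | suc v | h with h refl
    ...     | q , _ , eq₁ with guard-suc (halt k q n) eq₁
    ...     | (_ , h₁) , eq₂ with guard-suc (halt k m q) eq₂
    ...     | (_ , h₂) , eq₃ with guard-suc (halt k r q) eq₃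
    ...     | (_ , h₃) , refl = outside r q (Nr refl) (halt-∈ h₁) (halt-∈ h₂) (halt-∈ h₃)

    cert-suc : ∀ {n k r} → numeral k n ≡ suc r →
      (Σ ℕ λ v → halt k r n ≡ suc v) ⊎ (Σ ℕ λ v → bfind (cert₁ n k r) k ≡ suc v) →
      Σ ℕ λ v → cert n k ≡ suc v
    cert-suc {n} {k} {r} e≡ h with numeral k n
    cert-suc {n} {k} {r} refl (inj₁ (v , e≡)) | _ = 1 , natrec-suc e≡ (λ _ → refl)
    cert-suc {n} {k} {r} refl (inj₂ (v , e≡)) | _ with halt k r n
    ... | zero  = v , e≡
    ... | suc _ = 1 , refl

    cert-in : ∀ {n a} → Num n a → a ∈ n → ¬ ¬ (Σ ℕ λ k → Σ ℕ λ v → cert n k ≡ suc v)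
    cert-in {n} Na a∈n = numeral-complete n >>= λ (K , r , h) →
      ∈-halt (∈-respˡ (Num-unique n Na (numeral-sound K n (h K ≤-refl))) a∈n) >>= λ (K₁ , v , h₁) →
      return (K ⊔ K₁ , cert-suc (h _ (m≤m⊔n K K₁)) (inj₁ (v , h₁ _ (m≤n⊔m K K₁))))

    cert-out : ∀ {n a q} → Num n a → q ∈ n → m ∈ q → a ∈ q →
      ¬ ¬ (Σ ℕ λ k → Σ ℕ λ v → cert n k ≡ suc v)
    cert-out {n} {a} {q} Na q∈n m∈q a∈q = numeral-complete n >>= λ (K , r , h) →
      ∈-halt q∈n >>= λ (K₁ , _ , h₁) → ∈-halt m∈q >>= λ (K₂ , _ , h₂) →
      ∈-halt (∈-respˡ (Num-unique n Na (numeral-sound K n (h K ≤-refl))) a∈q) >>= λ (K₃ , _ , h₃) →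
      let k = K ⊔ (suc q ⊔ (K₁ ⊔ (K₂ ⊔ K₃)))
          l₁ = m≤n⊔m K (suc q ⊔ (K₁ ⊔ (K₂ ⊔ K₃)))
          l₂ = ≤-trans (m≤n⊔m (suc q) (K₁ ⊔ (K₂ ⊔ K₃))) l₁
          l₃ = ≤-trans (m≤n⊔m K₁ (K₂ ⊔ K₃)) l₂
          found = trans (guard-true (h₁ k (≤-trans (m≤m⊔n K₁ (K₂ ⊔ K₃)) l₂)))
                  (trans (guard-true (h₂ k (≤-trans (m≤m⊔n K₂ K₃) l₃)))
                         (guard-true (h₃ k (≤-trans (m≤n⊔m K₂ K₃) l₃))))
      in return (k , cert-suc {n} {k} (h k (m≤m⊔n K (suc q ⊔ (K₁ ⊔ (K₂ ⊔ K₃)))))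
           (inj₂ (bfind-complete (cert₁ n k r)
             (≤-trans (m≤m⊔n (suc q) (K₁ ⊔ (K₂ ⊔ K₃))) l₁) found)))

    m∉numeral : ∀ n {r} → Num n r → ¬ (m ∈ r)
    m∉numeral zero    N m∈r = ∉-empty N m∈r
    m∉numeral (suc n) N m∈r = N λ (y , Ny , _ , h) →
      m-not-numeral n (Num-resp n (≈-sym (h m m∈r)) Ny)

    contradiction : ⊥
    contradiction =
      -- `z`, `Z` and `m` now count as numbers: their numerals are the parameters of the search
      -- formula.
      Num-exists z λ (z' , Nz') → Num-exists Z λ (Z' , NZ') → Num-exists m λ (m' , Nm') →
      let
        ρ = z' ◂ Z' ◂ λ _ → m'
        γ = z ◂ Z ◂ λ _ → m
        G : ∀ i → Num (γ i) (ρ i)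
        G = λ where
          0 → Nz'
          1 → NZ'
          (suc (suc _)) → Nm'
        Φ : ℕ → Set
        Φ x = ⟦ searchF certT ⟧ (x ◂ V ◂ ρ)
      in
      sep (searchF certT) {{searchF-Δ₀ certT}} V ρ λ (S₀ , S₀-spec) →
      -- Variable 2 is `m`. Dropping the sets that contain `m` makes `T'` the only element of `n`
      -- with `m` in it.
      sep (¬' (2 ∈' 0)) S₀ (λ _ → m) λ (S , S-spec) →
      sep (¬' searchF certT) {{neg (searchF-Δ₀ certT)}} V ρ λ (T , T-spec) →
      adj-exists T m λ (T' , T⊆T' , m∈T' , T'⊆) →
      adj-exists S T' λ (n , S⊆n , T'∈n , n⊆) →
      -- Here `n`, so far a set of the model, is read as a number; `a` is its numeral.
      Num-exists n λ (a , Na) →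
      let
        aV = U a (Num-HF n Na)

        -- `a` lies in `S` or in `T`, and either fact is eventually certified.
        some : ¬ ¬ (Σ ℕ λ k → Σ ℕ λ v → cert n k ≡ suc v)
        some = excluded-middle (Φ a) >>= λ where
          (inj₁ φ) → cert-in Na (S⊆n a (proj₂ (S-spec a) (proj₂ (S₀-spec a) aV φ) (m∉numeral n Na)))
          (inj₂ ¬φ) → cert-out Na T'∈n m∈T' (T⊆T' a (proj₂ (T-spec a) aV ¬φ))

        refute : ∀ k b → cert n k ≡ b → Verdict n b → (∀ j → j < k → cert n j ≡ 0) →
          (Σ ℕ λ v → cert n k ≡ suc v) → ⊥
        refute = λ where
          k .0 e≡ none miss (_ , hit) → case trans (sym e≡) hit of λ ()
          -- The first certificate is 1, so the formula holds of `r`. As `m` is in `q`, `q` is `T'`;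
          -- but then `r` is in `T`, where the formula fails.
          k .1 e≡ (outside r q Nr q∈n m∈q r∈q) miss _ →
            let φ = Search.search-yes certT U G n Nr k e≡ miss in
            n⊆ q q∈n
              ((λ q∈S → proj₂ (proj₁ (S-spec q) q∈S) m∈q) ,
               λ q≈T' → T'⊆ r (∈-respʳ q≈T' r∈q)
                 ((λ r∈T → proj₂ (proj₁ (T-spec r) r∈T) φ) ,
                  λ r≈m → m-not-numeral n (Num-resp n r≈m Nr)))
          -- The first certificate is 2, so the formula fails at `r` and `r` is not in `S`; nor is
          -- `r` the set `T'`, since no numeral contains `m`.
          k .2 e≡ (inside r Nr r∈n) miss _ →
            n⊆ r r∈n
              ((λ r∈S → Search.search-no certT U G n Nr k e≡ miss
                 (proj₂ (proj₁ (S₀-spec r) (proj₁ (proj₁ (S-spec r) r∈S))))) ,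
               λ r≈T' → m∉numeral n Nr (∈-respʳ (≈-sym r≈T') m∈T'))
      in some λ (k , v , hit) →
         let k₀ , hit₀ , miss = least (cert n) k hit
         in refute k₀ (cert n k₀) refl (verdict n k₀) miss hit₀

theorem10 : (ε E : ℕ → ℕ → Set) → IsCE ε → IsCoCE E → IsEquivalence E →
    IsCongruence E ε → ¬ ModelOfKP ε E
theorem10 ε E (e , e-halts) _ eqv congr kp =
  universe-exists λ (V , U) →
  Num-exists 0 λ (z , Nz) → Num-exists 1 λ (l , Nl) → doub-exists z l λ (m , D) →
  sep (∀∈ 0 (∀∈ 1 (1 ≐ 0))) V id λ (Z , Z-spec) →
  Diagonal.contradiction e e-halts U Nz Z-spec (pair-not-numeral Nz Nl D)
  where open Model ε E eqv congr kp
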